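{- Let $p_1,p_2,p_3,p_4$ be integers with $4\le p_1\le p_2$, $p_3-p_2\ge p_1$ and $p_4-p_3\ge p_1$, and let $n>3(p_1-2)+\sum_{i=2}^4 p_i(p_i+1)$. Then $$sat(n,K_{p_1}\cup K_{p_2}\cup K_{p_3}\cup K_{p_4})=e(H(n;p_1,p_2,p_3,p_4))=(p_1-2)(n-p_1+2)+\sum_{i=2}^4\binom{p_i+1}{2},$$ and $H(n;p_1,p_2,p_3,p_4)$ is an extremal graph, i.e., it is an $n$-vertex $K_{p_1}\cup K_{p_2}\cup K_{p_3}\cup K_{p_4}$-saturated graph with exactly $sat(n,K_{p_1}\cup K_{p_2}\cup K_{p_3}\cup K_{p_4})$ edges.
   Context: All graphs are finite and simple; $e(G)$ is the number of edges of $G$. $K_m$ denotes the complete graph and $I_m$ the edgeless graph on $m$ vertices. For vertex-disjoint graphs $G,H$, $G\cup H$ is their disjoint union and $G\lor H$ is the join (add all edges between $V(G)$ and $V(H)$). $H(n;p_1,\dots,p_t)$ denotes the $n$-vertex graph $K_{p_1-2}\lor\bigl(K_{p_2+1}\cup\dots\cup K_{p_t+1}\cup I_{n-t+3-\sum_{i=1}^t p_i}\bigr)$. A graph $G$ is $F$-saturated if $G$ contains no subgraph isomorphic to $F$ but for every pair of nonadjacent vertices $u,v$, $G+uv$ contains a subgraph isomorphic to $F$. The saturation number $sat(n,F)$ is the minimum number of edges of an $F$-saturated graph on $n$ vertices. $K_{p_1}\cup\dots\cup K_{p_4}$ denotes the vertex-disjoint union of cliques of orders $p_1,\dots,p_4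$.
   Formalization: The closed formula for e(H(n;p_1,…,p_4)) is corrected by adding the term C(p_1−2,2), the edges inside K_{p_1−2}, which the stated formula omits (making it false for every p_1≥4, e.g. off by 1 when p_1=4). -}

module Defs where

open import Data.Nat using (ℕ; zero; suc; _+_; _*_; _∸_; _≤_; _<_; _<ᵇ_; _≡ᵇ_)
open import Data.Nat.Combinatorics using (_C_)
open import Data.Bool using (Bool; true; false; _∧_; _∨_; not; if_then_else_)
open import Data.Fin using (Fin; toℕ)
open import Data.List using (List; []; _∷_; map; allFin)
open import Data.Nat.ListAction using (sum)
open import Data.Product using (Σ; _×_; _,_)
open import Relation.Binary.PropositionalEquality using (_≡_; _≢_)
open import Relation.Nullary using (¬_)
open import Function.Definitions using (Injective)

record Graph (n : ℕ) : Set where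
  field
    Adj    : Fin n → Fin n → Bool
    sym    : ∀ u v → Adj u v ≡ Adj v u
    irrefl : ∀ v → Adj v v ≡ false
open Graph public

edges : ∀ {n} → Graph n → ℕ
edges {n} G =
  sum (map (λ i → sum (map (λ j →
        if (toℕ i <ᵇ toℕ j) ∧ Adj G i j then 1 else 0) (allFin n))) (allFin n))

ContainsAdj : ∀ {n m} → (Fin n → Fin n → Bool) → Graph m → Set
ContainsAdj {n} {m} A F =
  Σ (Fin m → Fin n) λ f →
    Injective _≡_ _≡_ f × (∀ x y → Adj F x y ≡ true → A (f x) (f y) ≡ true)

Contains : ∀ {n m} → Graph n → Graph m → Set
Contains G F = ContainsAdj (Adj G) F

addEdge : ∀ {n} → Graph n → Fin n → Fin n → Fin n → Fin n → Bool
addEdge G u v x y =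
  Adj G x y ∨ ((toℕ x ≡ᵇ toℕ u) ∧ (toℕ y ≡ᵇ toℕ v))
            ∨ ((toℕ x ≡ᵇ toℕ v) ∧ (toℕ y ≡ᵇ toℕ u))

Saturated : ∀ {n m} → Graph m → Graph n → Set
Saturated F G =
  ¬ Contains G F ×
  (∀ u v → u ≢ v → Adj G u v ≡ false → ContainsAdj (addEdge G u v) F)

SatNumberIs : ∀ {m} → (n : ℕ) → Graph m → ℕ → Set
SatNumberIs n F k =
  Σ (Graph n) (λ G → Saturated F G × edges G ≡ k) ×
  (∀ (G : Graph n) → Saturated F G → k ≤ edges G)

-- index of the block containing position v when ℕ is cut into consecutive
-- blocks of the given sizes (positions beyond all blocks get index = length)
blockOf : List ℕ → ℕ → ℕ
blockOf [] v = 0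
blockOf (p ∷ ps) v = if v <ᵇ p then 0 else suc (blockOf ps (v ∸ p))

K4union : (p1 p2 p3 p4 : ℕ) → Graph (p1 + p2 + p3 + p4)
K4union p1 p2 p3 p4 = record { Adj = A ; sym = s ; irrefl = ir }
  where
  bl = blockOf (p1 ∷ p2 ∷ p3 ∷ p4 ∷ [])
  A : _ → _ → Bool
  A x y = not (toℕ x ≡ᵇ toℕ y) ∧ (bl (toℕ x) ≡ᵇ bl (toℕ y))
  ≡ᵇ-sym : ∀ a b → (a ≡ᵇ b) ≡ (b ≡ᵇ a)
  ≡ᵇ-sym zero zero = _≡_.refl
  ≡ᵇ-sym zero (suc b) = _≡_.refl
  ≡ᵇ-sym (suc a) zero = _≡_.refl
  ≡ᵇ-sym (suc a) (suc b) = ≡ᵇ-sym a b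
  ≡ᵇ-refl : ∀ a → (a ≡ᵇ a) ≡ true
  ≡ᵇ-refl zero = _≡_.refl
  ≡ᵇ-refl (suc a) = ≡ᵇ-refl a
  s : ∀ u v → A u v ≡ A v u
  s u v rewrite ≡ᵇ-sym (toℕ u) (toℕ v) | ≡ᵇ-sym (bl (toℕ u)) (bl (toℕ v)) = _≡_.refl
  ir : ∀ v → A v v ≡ false
  ir v rewrite ≡ᵇ-refl (toℕ v) = _≡_.refl

-- H(n; p1,p2,p3,p4) = K_{p1-2} ∨ (K_{p2+1} ∪ K_{p3+1} ∪ K_{p4+1} ∪ I_{n-1-p1-p2-p3-p4}).
-- Vertices 0..p1-3 form K_{p1-2}; the following vertices are cut into blocks of
-- sizes p2+1, p3+1, p4+1 (block indices 0,1,2); remaining vertices (index 3) are isolated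
-- apart from the join.
Hgraph : (n p1 p2 p3 p4 : ℕ) → Graph n
Hgraph n p1 p2 p3 p4 = record { Adj = A ; sym = s ; irrefl = ir }
  where
  a = p1 ∸ 2
  bl : ℕ → ℕ
  bl w = blockOf (suc p2 ∷ suc p3 ∷ suc p4 ∷ []) (w ∸ a)
  core : ℕ → ℕ → Bool
  core x y = (x <ᵇ a) ∨ (y <ᵇ a) ∨ ((bl x ≡ᵇ bl y) ∧ (bl x <ᵇ 3))
  A : Fin n → Fin n → Bool
  A x y = not (toℕ x ≡ᵇ toℕ y) ∧ core (toℕ x) (toℕ y)
  ≡ᵇ-sym : ∀ a b → (a ≡ᵇ b) ≡ (b ≡ᵇ a)
  ≡ᵇ-sym zero zero = _≡_.refl
  ≡ᵇ-sym zero (suc b) = _≡_.refl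
  ≡ᵇ-sym (suc a) zero = _≡_.refl
  ≡ᵇ-sym (suc a) (suc b) = ≡ᵇ-sym a b
  ≡ᵇ-refl : ∀ a → (a ≡ᵇ a) ≡ true
  ≡ᵇ-refl zero = _≡_.refl
  ≡ᵇ-refl (suc a) = ≡ᵇ-refl a
  ∨-comm : ∀ b c → (b ∨ c) ≡ (c ∨ b)
  ∨-comm false false = _≡_.refl
  ∨-comm false true = _≡_.refl
  ∨-comm true false = _≡_.refl
  ∨-comm true true = _≡_.refl
  core-sym : ∀ x y → core x y ≡ core y x
  core-sym x y with bl x ≡ᵇ bl y in e
  ... | false rewrite ≡ᵇ-sym (bl y) (bl x) | e with x <ᵇ a | y <ᵇ a
  ...   | false | false = _≡_.refl
  ...   | false | true = _≡_.refl
  ...   | true | false = _≡_.refl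
  ...   | true | true = _≡_.refl
  core-sym x y | true = helper (bl x) (bl y) e
    where
    eqℕ : ∀ a b → (a ≡ᵇ b) ≡ true → a ≡ b
    eqℕ zero zero _ = _≡_.refl
    eqℕ (suc a) (suc b) p with eqℕ a b p
    ... | _≡_.refl = _≡_.refl
    helper : ∀ c d → (c ≡ᵇ d) ≡ true →
      ((x <ᵇ a) ∨ (y <ᵇ a) ∨ (true ∧ (c <ᵇ 3))) ≡
      ((y <ᵇ a) ∨ (x <ᵇ a) ∨ ((d ≡ᵇ c) ∧ (d <ᵇ 3)))
    helper c d p with eqℕ c d p
    ... | _≡_.refl rewrite ≡ᵇ-refl c with x <ᵇ a | y <ᵇ a
    ...   | false | false = _≡_.refl
    ...   | false | true = _≡_.refl
    ...   | true | false = _≡_.refl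
    ...   | true | true = _≡_.refl
  s : ∀ u v → A u v ≡ A v u
  s u v rewrite ≡ᵇ-sym (toℕ u) (toℕ v) | core-sym (toℕ u) (toℕ v) = _≡_.refl
  ir : ∀ v → A v v ≡ false
  ir v rewrite ≡ᵇ-refl (toℕ v) = _≡_.refl

{-# OPTIONS --safe #-}
-- Write a = p₁ - 2 and count arcs (ordered pairs of adjacent vertices).  In a
-- saturated graph two nonadjacent vertices have a clique of order at least a in
-- their common neighbourhood.  Let v have minimum degree δ ≥ a.  If δ > a, counting
-- the arcs around N(v) and the degrees of the vertices outside N[v] already gives
-- the bound, because n is large.  If δ = a, then N(v) is a dominating clique, and
-- for every w outside N[v] the rest W of the graph contains disjoint cliques
-- A_w, B_w, C_w of orders p₂, p₃, p₄ avoiding w.  It remains to find in W as many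
-- edges as in disjoint cliques of orders pᵢ + 1.  Let U be the union of the C_w.
-- If two of them meet in at most p₄ - 3 vertices, or if U has at least p₄ + 2
-- vertices, the edges outside a single A_w ∪ B_w ∪ C_w are numerous enough, thanks
-- to the gaps between the pᵢ.  Otherwise U is a clique of order p₄ + 1 that meets
-- each A_w and B_w in at most one vertex, so its edges can be deleted and the
-- argument repeated with the B_w, and then with the A_w.
module Submission where

open import Defs renaming (sym to adj-sym; irrefl to adj-irrefl)
open import Data.Bool using (Bool; true; false; T; _∧_; _∨_; not; if_then_else_)
import Data.Bool.Properties as Bool
open import Data.Empty using (⊥; ⊥-elim)
open import Data.Fin using (Fin; zero; suc; toℕ; _≟_; _↑ˡ_; _↑ʳ_)
open import Data.Fin.Properties using (any?; toℕ-injective; toℕ<n; toℕ-↑ˡ; toℕ-↑ʳ)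
open import Data.List using (List; []; _∷_; _∷ʳ_; map; tabulate; allFin)
open import Data.List.Properties using (map-tabulate)
open import Data.Nat using (ℕ; zero; suc; _+_; _*_; _∸_; _≤_; _<_; _≡ᵇ_; _<ᵇ_; z≤n; s≤s; s≤s⁻¹)
open import Data.Nat.Combinatorics using (_C_; nC1≡n; nCk+nC[k+1]≡[n+1]C[k+1])
open import Data.Nat.ListAction renaming (sum to total)
open import Data.Nat.Properties hiding (_≟_)
import Data.Nat.Properties as ℕ
open import Algebra.Properties.Semiring.Sum +-*-semiring using (sum; sum-cong-≗; ∑-distrib-+; ∑-comm; *-distribʳ-sum)
open import Data.Nat.Tactic.RingSolver using (solve-∀)
open import Data.Product using (Σ; ∃; _×_; _,_; proj₁; proj₂; uncurry)
open import Data.Sum using (_⊎_; inj₁; inj₂)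
open import Function using (_∘_)
open import Function.Definitions using (Injective)
open import Relation.Binary.PropositionalEquality hiding (J)
open import Relation.Nullary using (¬_; Dec; yes; no; does)
open import Relation.Nullary.Decidable using (_×-dec_; dec-true; dec-false)

-- Nothing relates the cliques of `T w` for different `w` in advance, so all counting is relative to
-- one `T w`. Let p, q, r be the three orders. A clique of order m + 1 has 2m more arcs than one of
-- order m, so the target is 2(p + q + r) arcs outside the cliques of a single `T w`. The gaps q ≥ p
-- + 4 and r ≥ q + 4 bound this target by 6r - 24, in terms of the largest order alone, which is why
-- that order is treated first. Two largest cliques meeting in at most r - 3 vertices supply 6r - 18
-- arcs; three vertices of U beyond one of its cliques supply 6(r - 2). The extra vertex in each
-- order p + 1 has a simple origin: a vertex w of U is missed by its own clique, so U has at least r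
-- + 1 vertices. The threshold on n comes from the case δ = a + 1. Let z count the arcs of disjoint
-- cliques of orders pᵢ + 1. The one unit of degree above a, collected over the vertices outside
-- N[v], must pay for z and for about 2a more arcs, which it does once n reaches 3a + z.

Subset : Set → Set
Subset A = A → Bool

private variable
  A B : Set
  n m k l : ℕ

⟦_⟧ : Bool → ℕ
⟦ b ⟧ = if b then 1 else 0

infix 4 _∈_ _∉_ _⊆_
infixl 6 _∩_ _∖_
infixl 7 _⊗_

-- The operations on subsets are opaque so that their arguments can be
-- inferred from the types of membership proofs.
opaque
  _∈_ : A → Subset A → Set
  x ∈ S = S x ≡ true

  _∩_ _∖_ : Subset A → Subset A → Subset A
  (S ∩ R) x = S x ∧ R x
  (S ∖ R) x = S x ∧ not (R x)

  _⊗_ : Subset A → Subset B → Subset (A × B)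
  (S ⊗ R) (x , y) = S x ∧ R y

  row : Subset (A × B) → A → Subset B
  row R x y = R (x , y)

  _ᵀ : Subset (A × B) → Subset (B × A)
  (R ᵀ) (y , x) = R (x , y)

  ∅ : Subset A
  ∅ _ = false

  full : Subset A
  full _ = true

  ｛_｝ : Fin n → Subset (Fin n)
  ｛ x ｝ y = does (x ≟ y)

  # : Subset (Fin n) → ℕ
  # S = sum (λ x → ⟦ S x ⟧)

  ## : Subset (Fin n × Fin m) → ℕ
  ## R = sum (λ x → sum (λ y → ⟦ R (x , y) ⟧))

  -- The arcs of the complete graph on S.
  off : Subset (Fin n) → Subset (Fin n × Fin n)
  off S (x , y) = (S x ∧ S y) ∧ not (does (x ≟ y))

_∉_ : A → Subset A → Set
x ∉ S = ¬ x ∈ S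

_⊆_ : Subset A → Subset A → Set
S ⊆ R = ∀ {x} → x ∈ S → x ∈ R

∧-true : ∀ {a b} → a ≡ true → b ≡ true → a ∧ b ≡ true
∧-true refl refl = refl

∧-trueˡ : ∀ {a b} → a ∧ b ≡ true → a ≡ true
∧-trueˡ {true} _ = refl

∧-trueʳ : ∀ {a b} → a ∧ b ≡ true → b ≡ true
∧-trueʳ {true} h = h

private variable
  S R Q : Subset A

opaque
  unfolding _∈_

  ∈-intro : ∀ {x : A} → S x ≡ true → x ∈ S
  ∈-intro h = h

  ∈-elim : ∀ {x : A} → x ∈ S → S x ≡ true
  ∈-elim h = h

  _∈?_ : (x : A) (S : Subset A) → Dec (x ∈ S)
  x ∈? S = S x Bool.≟ true

  ∉⇒false : ∀ {x : A} → x ∉ S → S x ≡ false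
  ∉⇒false = Bool.¬-not

  ∈-∩ : ∀ {x : A} → x ∈ S → x ∈ R → x ∈ S ∩ R
  ∈-∩ = ∧-true

  ∩-∈ˡ : ∀ {x : A} → x ∈ S ∩ R → x ∈ S
  ∩-∈ˡ = ∧-trueˡ

  ∩-∈ʳ : ∀ {x : A} → x ∈ S ∩ R → x ∈ R
  ∩-∈ʳ {S = S} {x = x} = ∧-trueʳ {S x}

  ∈-∖ : ∀ {x : A} → x ∈ S → x ∉ R → x ∈ S ∖ R
  ∈-∖ {S = S} {R = R} {x = x} s r = ∧-true {S x} s (cong not (∉⇒false {S = R} {x} r))

  ∖-∈ : ∀ {x : A} → x ∈ S ∖ R → x ∈ S
  ∖-∈ = ∧-trueˡ

  ∖-∉ : ∀ {x : A} → x ∈ S ∖ R → x ∉ R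
  ∖-∉ {S = S} {R = R} {x = x} h r with S x | R x
  ∖-∉ () r | true | true

  ∈-⊗ : ∀ {x : A} {y : B} → x ∈ S → y ∈ R → (x , y) ∈ S ⊗ R
  ∈-⊗ = ∧-true

  ⊗-∈ˡ : ∀ {x : A} {y : B} → (x , y) ∈ S ⊗ R → x ∈ S
  ⊗-∈ˡ = ∧-trueˡ

  ⊗-∈ʳ : ∀ {x : A} {y : B} → (x , y) ∈ S ⊗ R → y ∈ R
  ⊗-∈ʳ {S = S} {x = x} = ∧-trueʳ {S x}

  ∈-row : ∀ {R : Subset (A × B)} {x y} → (x , y) ∈ R → y ∈ row R x
  ∈-row h = h

  row-∈ : ∀ {R : Subset (A × B)} {x y} → y ∈ row R x → (x , y) ∈ R
  row-∈ h = h

  ∈-ᵀ : ∀ {R : Subset (A × B)} {x y} → (x , y) ∈ R → (y , x) ∈ R ᵀ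
  ∈-ᵀ h = h

  ᵀ-∈ : ∀ {R : Subset (A × B)} {x y} → (y , x) ∈ R ᵀ → (x , y) ∈ R
  ᵀ-∈ h = h

  ∉-∅ : {x : A} → x ∉ ∅
  ∉-∅ ()

  ∈-full : {x : A} → x ∈ full
  ∈-full = refl

  ∈-self : (x : Fin n) → x ∈ ｛ x ｝
  ∈-self x with x ≟ x
  ... | yes _ = refl
  ... | no x≢x = ⊥-elim (x≢x refl)

  ∈-｛｝ : {x y : Fin n} → y ∈ ｛ x ｝ → x ≡ y
  ∈-｛｝ {x = x} {y} h with x ≟ y
  ... | yes x≡y = x≡y

  ∈-off : {x y : Fin n} → x ∈ S → y ∈ S → x ≢ y → (x , y) ∈ off S
  ∈-off {x = x} {y} s t x≢y with x ≟ y
  ... | yes x≡y = ⊥-elim (x≢y x≡y)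
  ... | no _ = ∧-true (∧-true s t) refl

  off-∈ˡ : {x y : Fin n} → (x , y) ∈ off S → x ∈ S
  off-∈ˡ h = ∧-trueˡ (∧-trueˡ h)

  off-∈ʳ : {x y : Fin n} → (x , y) ∈ off S → y ∈ S
  off-∈ʳ {S = S} {x} h = ∧-trueʳ {S x} (∧-trueˡ h)

  off-≢ : {x y : Fin n} → (x , y) ∈ off S → x ≢ y
  off-≢ {S = S} {x} h refl with x ≟ x
  ... | yes _ with () ← ∧-trueʳ {S x ∧ S x} h
  off-≢ {S = S} {x} h refl | no x≢x = x≢x refl

-- Cardinality

sum-mono : (f g : Fin n → ℕ) → (∀ x → f x ≤ g x) → sum f ≤ sum g
sum-mono {zero} f g h = z≤n
sum-mono {suc n} f g h = +-mono-≤ (h zero) (sum-mono (f ∘ suc) (g ∘ suc) (h ∘ suc))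

sum-const : ∀ n k → sum {n} (λ _ → k) ≡ n * k
sum-const zero k = refl
sum-const (suc n) k = cong (k +_) (sum-const n k)

⟦⟧-mono : ∀ {a b} → (a ≡ true → b ≡ true) → ⟦ a ⟧ ≤ ⟦ b ⟧
⟦⟧-mono {false} h = z≤n
⟦⟧-mono {true} h rewrite h refl = ≤-refl

⟦⟧-peel : ∀ a b → (a ≡ true → b ≡ true) → ⟦ b ⟧ ≡ ⟦ a ⟧ + ⟦ b ∧ not a ⟧
⟦⟧-peel false b h rewrite Bool.∧-identityʳ b = refl
⟦⟧-peel true b h rewrite h refl = refl

⟦⟧-split : ∀ a b → ⟦ a ⟧ ≡ ⟦ a ∧ b ⟧ + ⟦ a ∧ not b ⟧
⟦⟧-split false b = refl
⟦⟧-split true false = refl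
⟦⟧-split true true = refl

opaque
  unfolding _∈_

  #-mono : {S R : Subset (Fin n)} → S ⊆ R → # S ≤ # R
  #-mono h = sum-mono _ _ λ x → ⟦⟧-mono (h {x})

  ##-mono : {S R : Subset (Fin n × Fin m)} → S ⊆ R → ## S ≤ ## R
  ##-mono h = sum-mono _ _ λ x → sum-mono _ _ λ y → ⟦⟧-mono (h {x , y})

  #-peel : {S R : Subset (Fin n)} → S ⊆ R → # R ≡ # S + # (R ∖ S)
  #-peel {S = S} {R} h =
    trans (sum-cong-≗ λ x → ⟦⟧-peel (S x) (R x) h) (∑-distrib-+ (⟦_⟧ ∘ S) (⟦_⟧ ∘ (R ∖ S)))

  ##-peel : {S R : Subset (Fin n × Fin m)} → S ⊆ R → ## R ≡ ## S + ## (R ∖ S)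
  ##-peel {S = S} {R} h =
    trans (sum-cong-≗ λ x → #-peel {S = row S x} {row R x} h)
          (∑-distrib-+ (λ x → # (row S x)) (λ x → # (row (R ∖ S) x)))

  #-split : (S R : Subset (Fin n)) → # S ≡ # (S ∩ R) + # (S ∖ R)
  #-split S R = trans (sum-cong-≗ λ x → ⟦⟧-split (S x) (R x)) (∑-distrib-+ (⟦_⟧ ∘ (S ∩ R)) (⟦_⟧ ∘ (S ∖ R)))

  ##-ᵀ : (R : Subset (Fin n × Fin m)) → ## (R ᵀ) ≡ ## R
  ##-ᵀ R = ∑-comm (λ y x → ⟦ R (x , y) ⟧)

  #-∅ : # {n} ∅ ≡ 0
  #-∅ {n} = trans (sum-const n 0) (*-zeroʳ n)

  #-full : # {n} full ≡ n
  #-full {n} = trans (sum-const n 1) (*-identityʳ n)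

  #-scale : ∀ a (S : Subset (Fin n)) → sum (λ x → ⟦ a ∧ S x ⟧) ≡ ⟦ a ⟧ * # S
  #-scale {n} false S = #-∅ {n}
  #-scale true S = sym (+-identityʳ _)

  ##-⊗ : (S : Subset (Fin n)) (R : Subset (Fin m)) → ## (S ⊗ R) ≡ # S * # R
  ##-⊗ S R = trans (sum-cong-≗ λ x → #-scale (S x) R) (sym (*-distribʳ-sum (# R) (⟦_⟧ ∘ S)))

  ##-rows : (S : Subset (Fin n)) (R : Subset (Fin n × Fin m)) →
    (∀ {x} → x ∈ S → k ≤ # (row R x)) → # S * k ≤ ## (R ∩ S ⊗ full)
  ##-rows {k = k} S R h = ≤-trans (≤-reflexive (*-distribʳ-sum k (⟦_⟧ ∘ S))) (sum-mono _ _ bound)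
    where
    bound : ∀ x → ⟦ S x ⟧ * k ≤ sum (λ y → ⟦ R (x , y) ∧ S x ∧ true ⟧)
    bound x with S x in e
    ... | false = z≤n
    ... | true = ≤-trans (≤-reflexive (+-identityʳ k))
                   (≤-trans (h e) (≤-reflexive (sum-cong-≗ λ y → cong ⟦_⟧ (sym (Bool.∧-identityʳ (R (x , y)))))))

  #-｛｝ : (x : Fin n) → # ｛ x ｝ ≡ 1
  #-｛｝ {suc n} zero = cong suc (#-∅ {n})
  #-｛｝ (suc x) = trans (sum-cong-≗ λ y → cong ⟦_⟧ (lift y)) (#-｛｝ x)
    where
    lift : ∀ y → does (suc x ≟ suc y) ≡ does (x ≟ y)
    lift y with x ≟ y
    ... | yes _ = refl
    ... | no _ = refl

  ##-off : (S : Subset (Fin n)) → ## (off S) + # S ≡ # S * # S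
  ##-off {n} S =
    trans (cong₂ _+_ (sum-cong-≗ λ x → sum-cong-≗ λ y → cong ⟦_⟧ (reorder (S x) (S y) (does (x ≟ y)))) (sym diagonal))
          (trans (+-comm _ (## D)) (trans (sym (##-peel {S = D} {S ⊗ S} D⊆)) (##-⊗ S S)))
    where
    D : Subset (Fin n × Fin n)
    D (x , y) = S x ∧ ｛ x ｝ y
    D⊆ : D ⊆ S ⊗ S
    D⊆ {x , y} h with refl ← ∈-｛｝ {x = x} {y} (∧-trueʳ {S x} h) = ∧-true {S x} {S x} (∧-trueˡ h) (∧-trueˡ h)
    reorder : ∀ a b c → (a ∧ b) ∧ not c ≡ (a ∧ b) ∧ not (a ∧ c)
    reorder false b c = refl
    reorder true b c = refl
    diagonal : ## D ≡ # S
    diagonal = sum-cong-≗ λ x → trans (#-scale (S x) ｛ x ｝) (trans (cong (⟦ S x ⟧ *_) (#-｛｝ x)) (*-identityʳ _))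

##-peel-≤ : {S R : Subset (Fin n × Fin m)} → S ⊆ R → k ≤ ## S → l ≤ ## (R ∖ S) → k + l ≤ ## R
##-peel-≤ h k≤ l≤ = ≤-trans (+-mono-≤ k≤ l≤) (≤-reflexive (sym (##-peel h)))

#-∪ : {S R Q : Subset (Fin n)} → (∀ {x} → x ∈ Q → x ∈ S ⊎ x ∈ R) → # Q ≤ # S + # R
#-∪ {S = S} {R} {Q} h =
  ≤-trans (≤-reflexive (#-split Q S))
    (+-mono-≤ (#-mono ∩-∈ʳ) (#-mono λ x∈ → case₁ (h (∖-∈ x∈)) (∖-∉ x∈)))
  where
  case₁ : ∀ {x} → x ∈ S ⊎ x ∈ R → x ∉ S → x ∈ R
  case₁ (inj₁ s) ∉S = ⊥-elim (∉S s)
  case₁ (inj₂ r) _ = r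

#-disjoint : {S R Q : Subset (Fin n)} → S ⊆ Q → R ⊆ Q → (∀ {x} → x ∈ S → x ∉ R) → # S + # R ≤ # Q
#-disjoint {S = S} S⊆Q R⊆Q dis =
  ≤-trans (+-monoʳ-≤ (# S) (#-mono λ r → ∈-∖ (R⊆Q r) λ s → dis s r)) (≤-reflexive (sym (#-peel S⊆Q)))

#-insert : {S R : Subset (Fin n)} {x : Fin n} → S ⊆ R → x ∈ R → x ∉ S → suc (# S) ≤ # R
#-insert {S = S} {R} {x} S⊆R x∈R x∉S =
  subst (λ z → z + # S ≤ # R) (#-｛｝ x)
    (#-disjoint (λ h → subst (_∈ R) (∈-｛｝ h) x∈R) S⊆R λ h s → x∉S (subst (_∈ S) (sym (∈-｛｝ h)) s))

#-insert₂ : {S R : Subset (Fin n)} {x y : Fin n} →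
  S ⊆ R → x ∈ R → x ∉ S → y ∈ R → y ∉ S → x ≢ y → 2 + # S ≤ # R
#-insert₂ {S = S} S⊆R x∈R x∉S y∈R y∉S x≢y =
  ≤-trans (s≤s (#-insert (λ s → ∈-∖ (S⊆R s) λ e → y∉S (subst (_∈ S) (sym (∈-｛｝ e)) s))
                         (∈-∖ x∈R λ e → x≢y (sym (∈-｛｝ e))) x∉S))
          (#-insert ∖-∈ y∈R λ h → ∖-∉ h (∈-self _))

⊆-≥⇒⊇ : {S R : Subset (Fin n)} → S ⊆ R → # R ≤ # S → R ⊆ S
⊆-≥⇒⊇ {S = S} S⊆R R≤S {x} x∈R with x ∈? S
... | yes x∈S = x∈S
... | no x∉S = ⊥-elim (<⇒≱ (#-insert S⊆R x∈R x∉S) R≤S)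

opaque
  #-pick-∖ : (S R : Subset (Fin n)) → # S < # R → ∃ λ x → x ∈ R × x ∉ S
  #-pick-∖ S R S<R with any? (_∈? (R ∖ S))
  ... | yes (x , h) = x , ∖-∈ h , ∖-∉ h
  ... | no ¬p = ⊥-elim (<⇒≱ S<R (#-mono R⊆S))
    where
    R⊆S : R ⊆ S
    R⊆S {x} x∈R with x ∈? S
    ... | yes x∈S = x∈S
    ... | no x∉S = ⊥-elim (¬p (x , ∈-∖ x∈R x∉S))

  #-pick : (S : Subset (Fin n)) → 1 ≤ # S → ∃ λ x → x ∈ S
  #-pick {n} S 1≤ with #-pick-∖ ∅ S (subst (_< # S) (sym (#-∅ {n})) 1≤)
  ... | x , x∈S , _ = x , x∈S

#-∅-≤ : {S : Subset (Fin n)} → (∀ {x} → x ∉ S) → # S ≡ 0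
#-∅-≤ {n} h = n≤0⇒n≡0 (≤-trans (#-mono λ s → ⊥-elim (h s)) (≤-reflexive (#-∅ {n})))

-- Arithmetic of arc counts

-- Twice the binomial coefficient, so that halving can wait until `arcs-C`.
arcs : ℕ → ℕ
arcs m = m * (m ∸ 1)

arcs-+ : ∀ m → arcs m + m ≡ m * m
arcs-+ zero = refl
arcs-+ (suc m) = identity m
  where
  identity : ∀ m → suc m * m + suc m ≡ suc m * suc m
  identity = solve-∀

arcs-suc : ∀ m → arcs (suc m) ≡ arcs m + 2 * m
arcs-suc zero = refl
arcs-suc (suc m) = identity m
  where
  identity : ∀ m → suc (suc m) * suc m ≡ suc m * m + 2 * suc m
  identity = solve-∀

arcs-mono : ∀ {k m} → k ≤ m → arcs k ≤ arcs m
arcs-mono k≤m = *-mono-≤ k≤m (∸-monoˡ-≤ 1 k≤m)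

arcs-+-split : ∀ k m → arcs (k + m) ≡ arcs k + arcs m + 2 * (k * m)
arcs-+-split k m = +-cancelʳ-≡ (k + m) _ _ (begin
  arcs (k + m) + (k + m)                      ≡⟨ arcs-+ (k + m) ⟩
  (k + m) * (k + m)                           ≡⟨ square k m ⟩
  k * k + m * m + 2 * (k * m)                 ≡⟨ cong₂ (λ x y → x + y + 2 * (k * m)) (arcs-+ k) (arcs-+ m) ⟨
  arcs k + k + (arcs m + m) + 2 * (k * m)     ≡⟨ regroup (arcs k) (arcs m) k m (2 * (k * m)) ⟩
  arcs k + arcs m + 2 * (k * m) + (k + m)     ∎)
  where
  open ≡-Reasoning
  square : ∀ k m → (k + m) * (k + m) ≡ k * k + m * m + 2 * (k * m)
  square = solve-∀
  regroup : ∀ x y k m z → x + k + (y + m) + z ≡ x + y + z + (k + m)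
  regroup = solve-∀

arcs-super : ∀ k m → arcs k + arcs m ≤ arcs (k + m)
arcs-super k m = ≤-trans (m≤m+n _ _) (≤-reflexive (sym (arcs-+-split k m)))

-- Certificates for linear consequences: a ≤ b follows from L ≤ R once b - a = (R - L) + k.
linear : ∀ {L R a b} k → L ≤ R → a + R + k ≡ b + L → a ≤ b
linear {L} {R} {a} {b} k L≤R e =
  +-cancelʳ-≤ L a b (≤-trans (+-monoʳ-≤ a L≤R) (≤-trans (m≤m+n _ k) (≤-reflexive e)))

-- A part of order k sends k(m - k) edges to the other m - k vertices. This is concave in k, so on 3
-- ≤ k ≤ m - 3 it is least at the ends, with value 3(m - 3); in arcs, 6m - 18.
arcs-cut : ∀ {k l m} → 3 ≤ k → k + 3 ≤ m → k + l ≤ m → arcs k + arcs l + 6 * m ≤ arcs m + 18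
arcs-cut {k} {l} {m} 3≤k k+3≤m k+l≤m with m≤n⇒∃[o]m+o≡n 3≤k | m≤n⇒∃[o]m+o≡n k+3≤m
... | i , refl | j , refl = begin
  arcs k + arcs l + 6 * m       ≤⟨ +-monoˡ-≤ (6 * m) (+-monoʳ-≤ (arcs k) (arcs-mono l≤)) ⟩
  arcs k + arcs (3 + j) + 6 * m ≤⟨ linear (2 * (i * j)) ≤-refl (certificate i j (arcs k) (arcs (3 + j))) ⟩
  arcs k + arcs (3 + j) + 2 * (k * (3 + j)) + 18 ≡⟨ cong (_+ 18) (trans (cong arcs (+-assoc k 3 j)) (arcs-+-split k (3 + j))) ⟨
  arcs m + 18                   ∎
  where
  open ≤-Reasoning
  l≤ : l ≤ 3 + j
  l≤ = +-cancelˡ-≤ k l (3 + j) (≤-trans k+l≤m (≤-reflexive (+-assoc k 3 j)))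
  certificate : ∀ i j x y → x + y + 6 * (3 + i + 3 + j) + 0 + 2 * (i * j) ≡ x + y + 2 * ((3 + i) * (3 + j)) + 18 + 0
  certificate = solve-∀

-- A clique of order m cut into pieces, none of which has more than m - 3
-- vertices, has at least 3(m - 3) edges between the pieces.
arcs-spread : ∀ {a b c m} → 4 ≤ m → a + 3 ≤ m → b + 3 ≤ m → c + 3 ≤ m → a + b + c ≤ m →
  arcs a + arcs b + arcs c + 6 * m ≤ arcs m + 18
arcs-spread {a} {b} {c} {m} 4≤m a≤ b≤ c≤ sum≤ with 3 ≤? a | 3 ≤? b | 3 ≤? c
... | yes 3≤a | _ | _ =
  ≤-trans (+-monoˡ-≤ (6 * m) (≤-trans (≤-reflexive (+-assoc (arcs a) _ _)) (+-monoʳ-≤ (arcs a) (arcs-super b c))))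
          (arcs-cut 3≤a a≤ (≤-trans (≤-reflexive (sym (+-assoc a b c))) sum≤))
... | no _ | yes 3≤b | _ =
  ≤-trans (+-monoˡ-≤ (6 * m) (≤-trans (≤-reflexive (regroup (arcs a) (arcs b) (arcs c))) (+-monoʳ-≤ (arcs b) (arcs-super a c))))
          (arcs-cut 3≤b b≤ (≤-trans (≤-reflexive (sym (regroup a b c))) sum≤))
  where
  regroup : ∀ x y z → x + y + z ≡ y + (x + z)
  regroup = solve-∀
... | no _ | no _ | yes 3≤c =
  ≤-trans (+-monoˡ-≤ (6 * m) (≤-trans (≤-reflexive (+-comm (arcs a + arcs b) _)) (+-monoʳ-≤ (arcs c) (arcs-super a b))))
          (arcs-cut 3≤c c≤ (≤-trans (≤-reflexive (+-comm c _)) sum≤))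
-- All pieces have at most 2 vertices, hence at most 6 arcs together, and the claim becomes (m -
-- 3)(m - 4) ≥ 0.
... | no a≱3 | no b≱3 | no c≱3 with m≤n⇒∃[o]m+o≡n 4≤m
...   | j , refl =
  ≤-trans (+-monoˡ-≤ (6 * (4 + j)) (+-mono-≤ (+-mono-≤ (small a≱3) (small b≱3)) (small c≱3)))
          (linear (j + j * j) ≤-refl (certificate j))
  where
  small : ∀ {x} → ¬ 3 ≤ x → arcs x ≤ 2
  small x≱3 = arcs-mono {m = 2} (s≤s⁻¹ (≰⇒> x≱3))
  certificate : ∀ j → 2 + 2 + 2 + 6 * (4 + j) + 0 + (j + j * j) ≡ (4 + j) * (3 + j) + 18 + 0
  certificate = solve-∀

-- Families of disjoint cliques

##-off-arcs : (S : Subset (Fin n)) → ## (off S) ≡ arcs (# S)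
##-off-arcs S = +-cancelʳ-≡ (# S) _ _ (trans (##-off S) (sym (arcs-+ (# S))))

Symm : Subset (A × A) → Set
Symm E = ∀ {x y} → (x , y) ∈ E → (y , x) ∈ E

Irreflexive : Subset (A × A) → Set
Irreflexive E = ∀ {x} → (x , x) ∉ E

-- The order 0 is allowed: empty cliques pad the shorter families, so that all three rounds of the
-- induction share this record.
record Cliques (E : Subset (Fin n × Fin n)) (p q r : ℕ) (w : Fin n) : Set where
  field
    P₁ P₂ P₃ : Subset (Fin n)
    size₁ : # P₁ ≡ p
    size₂ : # P₂ ≡ q
    size₃ : # P₃ ≡ r
    clique₁ : off P₁ ⊆ E
    clique₂ : off P₂ ⊆ E
    clique₃ : off P₃ ⊆ E
    disjoint₁₂ : ∀ {x} → x ∈ P₁ → x ∉ P₂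
    disjoint₁₃ : ∀ {x} → x ∈ P₁ → x ∉ P₃
    disjoint₂₃ : ∀ {x} → x ∈ P₂ → x ∉ P₃
    avoid₁ : w ∉ P₁
    avoid₂ : w ∉ P₂
    avoid₃ : w ∉ P₃
open Cliques

off-disjoint : ∀ {S R : Subset (Fin n)} {x y} → (∀ {z} → z ∈ S → z ∉ R) → (x , y) ∈ off S → (x , y) ∉ off R
off-disjoint dis s r = dis (off-∈ˡ s) (off-∈ˡ r)

module _ {E : Subset (Fin n × Fin n)} {p q r : ℕ} {w : Fin n} (T : Cliques E p q r w) where

  outside : Subset (Fin n × Fin n)
  outside = E ∖ off (P₁ T) ∖ off (P₂ T) ∖ off (P₃ T)

  ∈-outside : ∀ {x y} → (x , y) ∈ E → (x , y) ∉ off (P₁ T) → (x , y) ∉ off (P₂ T) → (x , y) ∉ off (P₃ T) →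
    (x , y) ∈ outside
  ∈-outside e ∉₁ ∉₂ ∉₃ = ∈-∖ (∈-∖ (∈-∖ e ∉₁) ∉₂) ∉₃

  outside-count : ## E ≡ arcs p + (arcs q + (arcs r + ## outside))
  outside-count = trans (##-peel (clique₁ T)) (cong₂ _+_ (size (size₁ T))
    (trans (##-peel λ h → ∈-∖ (clique₂ T h) λ h′ → off-disjoint (disjoint₁₂ T) h′ h) (cong₂ _+_ (size (size₂ T))
    (trans (##-peel λ h → ∈-∖ (∈-∖ (clique₃ T h) λ h′ → off-disjoint (disjoint₁₃ T) h′ h)
                                                 λ h′ → off-disjoint (disjoint₂₃ T) h′ h)
           (cong (_+ ## outside) (size (size₃ T)))))))
    where
    size : ∀ {S m} → # S ≡ m → ## (off S) ≡ arcs m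
    size {S} refl = ##-off-arcs S

  -- Since `arcs (suc m)` is `arcs m + 2 * m`, this many outside arcs make up for one missing vertex
  -- in each of the three cliques.
  outside-bound : 2 * (p + q + r) ≤ ## outside → arcs (suc p) + arcs (suc q) + arcs (suc r) ≤ ## E
  outside-bound h = begin
    arcs (suc p) + arcs (suc q) + arcs (suc r)       ≡⟨ cong₂ _+_ (cong₂ _+_ (arcs-suc p) (arcs-suc q)) (arcs-suc r) ⟩
    arcs p + 2 * p + (arcs q + 2 * q) + (arcs r + 2 * r) ≡⟨ regroup (arcs p) (arcs q) (arcs r) p q r ⟩
    arcs p + (arcs q + (arcs r + 2 * (p + q + r)))   ≤⟨ +-monoʳ-≤ (arcs p) (+-monoʳ-≤ (arcs q) (+-monoʳ-≤ (arcs r) h)) ⟩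
    arcs p + (arcs q + (arcs r + ## outside))        ≡⟨ outside-count ⟨
    ## E                                             ∎
    where
    open ≤-Reasoning
    regroup : ∀ x y z p q r → x + 2 * p + (y + 2 * q) + (z + 2 * r) ≡ x + (y + (z + 2 * (p + q + r)))
    regroup = solve-∀

  -- An arc of `S` that lies in one of the three cliques has both ends in the corresponding piece of
  -- `S`; every other arc of `S` is outside.
  clique-outside : (S : Subset (Fin n)) → off S ⊆ E →
    arcs (# S) ≤ arcs (# (S ∩ P₁ T)) + (arcs (# (S ∩ P₂ T)) + (arcs (# (S ∩ P₃ T)) + ## outside))
  clique-outside S cl = begin
    arcs (# S)                                     ≡⟨ ##-off-arcs S ⟨
    ## (off S)                                     ≡⟨ ##-peel (λ h → restrict h) ⟩
    ## (off (S ∩ P₁ T)) + ## (off S ∖ off (S ∩ P₁ T)) ≡⟨ cong₂ _+_ (##-off-arcs (S ∩ P₁ T)) (##-peel λ h → ∈-∖ (restrict h)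
        λ h′ → disjoint₁₂ T (∩-∈ʳ (off-∈ˡ h′)) (∩-∈ʳ (off-∈ˡ h))) ⟩
    arcs (# (S ∩ P₁ T)) + (## (off (S ∩ P₂ T)) + ## (off S ∖ off (S ∩ P₁ T) ∖ off (S ∩ P₂ T)))
      ≡⟨ cong (arcs (# (S ∩ P₁ T)) +_) (cong₂ _+_ (##-off-arcs (S ∩ P₂ T)) (##-peel λ h → ∈-∖ (∈-∖ (restrict h)
        λ h′ → disjoint₁₃ T (∩-∈ʳ (off-∈ˡ h′)) (∩-∈ʳ (off-∈ˡ h)))
        λ h′ → disjoint₂₃ T (∩-∈ʳ (off-∈ˡ h′)) (∩-∈ʳ (off-∈ˡ h)))) ⟩
    arcs (# (S ∩ P₁ T)) + (arcs (# (S ∩ P₂ T)) + (## (off (S ∩ P₃ T)) + ## rest))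
      ≤⟨ +-monoʳ-≤ (arcs (# (S ∩ P₁ T))) (+-monoʳ-≤ (arcs (# (S ∩ P₂ T))) (+-mono-≤ (≤-reflexive (##-off-arcs (S ∩ P₃ T)))
           (##-mono λ {x} → rest⊆ {x}))) ⟩
    arcs (# (S ∩ P₁ T)) + (arcs (# (S ∩ P₂ T)) + (arcs (# (S ∩ P₃ T)) + ## outside)) ∎
    where
    open ≤-Reasoning
    rest : Subset (Fin n × Fin n)
    rest = off S ∖ off (S ∩ P₁ T) ∖ off (S ∩ P₂ T) ∖ off (S ∩ P₃ T)
    restrict : ∀ {R} → off (S ∩ R) ⊆ off S
    restrict h = ∈-off (∩-∈ˡ (off-∈ˡ h)) (∩-∈ˡ (off-∈ʳ h)) (off-≢ h)
    meet : ∀ {R x y} → (x , y) ∈ off S → (x , y) ∈ off R → (x , y) ∈ off (S ∩ R)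
    meet s t = ∈-off (∈-∩ (off-∈ˡ s) (off-∈ˡ t)) (∈-∩ (off-∈ʳ s) (off-∈ʳ t)) (off-≢ s)
    rest⊆ : rest ⊆ outside
    rest⊆ h = ∈-outside (cl s) (λ h′ → ∖-∉ (∖-∈ (∖-∈ h)) (meet s h′)) (λ h′ → ∖-∉ (∖-∈ h) (meet s h′)) (λ h′ → ∖-∉ h (meet s h′))
      where s = ∖-∈ (∖-∈ (∖-∈ h))

  parts-≤ : (S : Subset (Fin n)) → # (S ∩ P₁ T) + # (S ∩ P₂ T) + # (S ∩ P₃ T) ≤ # S
  parts-≤ S = begin
    # (S ∩ P₁ T) + # (S ∩ P₂ T) + # (S ∩ P₃ T)   ≡⟨ +-assoc (# (S ∩ P₁ T)) _ _ ⟩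
    # (S ∩ P₁ T) + (# (S ∩ P₂ T) + # (S ∩ P₃ T)) ≤⟨ +-monoʳ-≤ (# (S ∩ P₁ T)) (#-disjoint {Q = S ∖ P₁ T}
        (λ h → ∈-∖ (∩-∈ˡ h) λ h′ → disjoint₁₂ T h′ (∩-∈ʳ h)) (λ h → ∈-∖ (∩-∈ˡ h) λ h′ → disjoint₁₃ T h′ (∩-∈ʳ h))
        λ h h′ → disjoint₂₃ T (∩-∈ʳ h) (∩-∈ʳ h′)) ⟩
    # (S ∩ P₁ T) + # (S ∖ P₁ T)                  ≡⟨ #-split S (P₁ T) ⟨
    # S                                          ∎
    where open ≤-Reasoning

  -- Vertices of U ∖ P₃ with many neighbours in P₃ supply arcs outside the cliques.
  module _ (symm : Symm E) (U : Subset (Fin n)) where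

    bridge : Subset (Fin n × Fin n)
    bridge = E ∩ (U ∖ P₃ T) ⊗ P₃ T

    private
      bridge-outside : bridge ⊆ outside
      bridge-outside h = ∈-outside (∩-∈ˡ h) (λ o → disjoint₁₃ T (off-∈ʳ o) y∈) (λ o → disjoint₂₃ T (off-∈ʳ o) y∈) (λ o → x∉ (off-∈ˡ o))
        where
        y∈ = ⊗-∈ʳ (∩-∈ʳ h)
        x∉ = ∖-∉ (⊗-∈ˡ (∩-∈ʳ h))

    -- Each bridge counts in both directions, hence the repeated term. The slack `l` leaves room for
    -- arcs found elsewhere.
    bridge-count : ∀ {l} → (∀ {x} → x ∈ U ∖ P₃ T → k ≤ # (row E x ∩ P₃ T)) → l ≤ ## (outside ∖ bridge ∖ bridge ᵀ) →
      # (U ∖ P₃ T) * k + (# (U ∖ P₃ T) * k + l) ≤ ## outside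
    bridge-count {k = k} nbrs rest =
      ##-peel-≤ (λ {x} → bridge-outside {x}) rows
        (##-peel-≤ (λ {x} → turned {x}) (≤-trans rows (≤-reflexive (sym (##-ᵀ bridge)))) rest)
      where
      rows : # (U ∖ P₃ T) * k ≤ ## bridge
      rows = ≤-trans (##-rows (U ∖ P₃ T) bridge λ x∈ → ≤-trans (nbrs x∈)
               (#-mono λ h → ∈-row (∈-∩ (row-∈ (∩-∈ˡ h)) (∈-⊗ x∈ (∩-∈ʳ h))))) (##-mono ∩-∈ˡ)
      turned : bridge ᵀ ⊆ outside ∖ bridge
      turned {y , x} h = ∈-∖ (∈-outside (symm (∩-∈ˡ (ᵀ-∈ h)))
          (λ o → disjoint₁₃ T (off-∈ˡ o) y∈) (λ o → disjoint₂₃ T (off-∈ˡ o) y∈) (λ o → x∉ (off-∈ʳ o)))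
          λ b → x∉ (⊗-∈ʳ (∩-∈ʳ b))
        where
        y∈ = ⊗-∈ʳ (∩-∈ʳ (ᵀ-∈ h))
        x∉ = ∖-∉ (⊗-∈ˡ (∩-∈ʳ (ᵀ-∈ h)))

    -- No arc at `u` lies in a clique or a bridge, because `u` is in none of the cliques and not in
    -- `U`. Both directions count again.
    star-count : Irreflexive E → ∀ {u l} → u ∉ U → u ∉ P₁ T → u ∉ P₂ T → u ∉ P₃ T → l ≤ # (row E u) →
      l + l ≤ ## (outside ∖ bridge ∖ bridge ᵀ)
    star-count irr {u} {l} ∉U ∉₁ ∉₂ ∉₃ deg =
      ##-peel-≤ (λ {x} → star⊆ {x}) size (≤-trans size (≤-trans (≤-reflexive (sym (##-ᵀ star))) (##-mono λ {x} → starᵀ⊆ {x})))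
      where
      star : Subset (Fin n × Fin n)
      star = E ∩ ｛ u ｝ ⊗ full
      size : l ≤ ## star
      size = ≤-trans (≤-reflexive (sym (trans (cong (_* l) (#-｛｝ u)) (+-identityʳ l))))
               (##-rows ｛ u ｝ E λ h → subst (λ x → l ≤ # (row E x)) (∈-｛｝ h) deg)
      free : ∀ {S x y} → (x , y) ∈ star → u ∉ S → x ∉ S
      free {S} h u∉ x∈ = u∉ (subst (_∈ S) (sym (∈-｛｝ (⊗-∈ˡ (∩-∈ʳ h)))) x∈)
      star⊆ : star ⊆ outside ∖ bridge ∖ bridge ᵀ
      star⊆ {x , y} h = ∈-∖ (∈-∖ (∈-outside (∩-∈ˡ h) (free h ∉₁ ∘ off-∈ˡ) (free h ∉₂ ∘ off-∈ˡ) (free h ∉₃ ∘ off-∈ˡ))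
        (free h ∉U ∘ ∖-∈ ∘ ⊗-∈ˡ ∘ ∩-∈ʳ)) (free h ∉₃ ∘ ⊗-∈ʳ ∘ ∩-∈ʳ ∘ ᵀ-∈)
      starᵀ⊆ : star ᵀ ⊆ outside ∖ bridge ∖ bridge ᵀ ∖ star
      starᵀ⊆ {y , x} h′ = ∈-∖ (∈-∖ (∈-∖ (∈-outside (symm (∩-∈ˡ h)) (free h ∉₁ ∘ off-∈ʳ) (free h ∉₂ ∘ off-∈ʳ) (free h ∉₃ ∘ off-∈ʳ))
        (free h ∉₃ ∘ ⊗-∈ʳ ∘ ∩-∈ʳ)) (free h ∉U ∘ ∖-∈ ∘ ⊗-∈ˡ ∘ ∩-∈ʳ ∘ ᵀ-∈))
        λ s → irr (subst (λ z → (z , x) ∈ E) (trans (sym (∈-｛｝ (⊗-∈ˡ (∩-∈ʳ s)))) (∈-｛｝ (⊗-∈ˡ (∩-∈ʳ h)))) (∩-∈ˡ s))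
        where h = ᵀ-∈ h′

-- The union of the largest cliques of a family

module _ {E : Subset (Fin n × Fin n)} {p q r : ℕ} (symm : Symm E) (irr : Irreflexive E)
         (T : ∀ w → Cliques E p q r w) where

  opaque
    top : Subset (Fin n)
    top x = does (any? λ w → x ∈? P₃ (T w))

  opaque
    unfolding top

    ∈-top : ∀ w → P₃ (T w) ⊆ top
    ∈-top w {x} h with any? (λ w → x ∈? P₃ (T w)) in e
    ... | yes _ = ∈-intro (cong does e)
    ... | no ¬p = ⊥-elim (¬p (w , h))

    top-∈ : ∀ {x} → x ∈ top → ∃ λ w → x ∈ P₃ (T w)
    top-∈ {x} h with any? (λ w → x ∈? P₃ (T w)) in e
    ... | yes p = p
    ... | no ¬p with () ← trans (sym (cong does e)) (∈-elim h)

  -- Two is the largest tolerable loss: an overlap smaller by three or more already yields enough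
  -- outside arcs, through the hypothesis `far` of `peel-top`.
  Close : Set
  Close = ∀ w w′ → r ≤ # (P₃ (T w′) ∩ P₃ (T w)) + 2

  close? : (∃ λ w → ∃ λ w′ → # (P₃ (T w′) ∩ P₃ (T w)) + 3 ≤ r) ⊎ Close
  close? with any? (λ w → any? (λ w′ → # (P₃ (T w′) ∩ P₃ (T w)) + 3 ≤? r))
  ... | yes (w , w′ , h) = inj₁ (w , w′ , h)
  ... | no ¬p = inj₂ λ w w′ → s≤s⁻¹ (≤-trans (≰⇒> λ h → ¬p (w , w′ , h)) (≤-reflexive (+-suc _ 2)))

  -- The clique `P₃ (T w)` lies in the union but avoids `w`.
  top-size : ∀ {w} → w ∈ top → suc r ≤ # top
  top-size {w} h = subst (λ k → suc k ≤ # top) (size₃ (T w)) (#-insert (∈-top w) h (avoid₃ (T w)))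

  -- The vertex `x` lies in some other clique `P₃ (T w′)`, which shares at least r - 2 vertices with
  -- `P₃ (T w)`; all of these are neighbours of `x`.
  top-bridge : Close → ∀ w {k} → r ≡ k + 2 → ∀ {x} → x ∈ top ∖ P₃ (T w) → k ≤ # (row E x ∩ P₃ (T w))
  top-bridge close w {k} e {x} x∈ with top-∈ (∖-∈ x∈)
  ... | w′ , x∈C = ≤-trans (+-cancelʳ-≤ 2 k _ (subst (_≤ _) e (close w w′)))
    (#-mono λ h → ∈-∩ (∈-row (clique₃ (T w′) (∈-off x∈C (∩-∈ˡ h) λ { refl → ∖-∉ x∈ (∩-∈ʳ h) }))) (∩-∈ʳ h))

  top-excess : ∀ w {k} → k + r ≤ # top → k ≤ # (top ∖ P₃ (T w))
  top-excess w {k} h = +-cancelʳ-≤ r k _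
    (≤-trans h (≤-reflexive (trans (#-peel (∈-top w)) (trans (+-comm _ (# (top ∖ P₃ (T w)))) (cong (# (top ∖ P₃ (T w)) +_) (size₃ (T w)))))))

  module _ (2≤r : 2 ≤ r) (small : # top ≤ suc r) where

    top-missing : ∀ w {x y} → x ∈ top → x ∉ P₃ (T w) → y ∈ top → y ∉ P₃ (T w) → x ≡ y
    top-missing w {x} {y} x∈ x∉ y∈ y∉ with x ≟ y
    ... | yes x≡y = x≡y
    ... | no x≢y = ⊥-elim (<⇒≱ (s≤s small) (subst (λ k → 2 + k ≤ # top) (size₃ (T w)) (#-insert₂ (∈-top w) x∈ x∉ y∈ y∉ x≢y)))

    -- Given two vertices of the union, take a third vertex `w` of it. The clique `P₃ (T w)` misses
    -- `w` and, by cardinality, nothing else, so it contains the two. A third vertex exists because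
    -- r + 1 ≥ 3.
    top-clique : off top ⊆ E
    top-clique {x , y} h with any? (λ w → w ∈? (top ∖ ｛ x ｝ ∖ ｛ y ｝))
    ... | yes (w , w∈) = clique₃ (T w) (∈-off (inside x∈ x≢w) (inside y∈ y≢w) (off-≢ h))
      where
      x∈ = off-∈ˡ h
      y∈ = off-∈ʳ h
      x≢w : x ≢ w
      x≢w refl = ∖-∉ (∖-∈ w∈) (∈-self x)
      y≢w : y ≢ w
      y≢w refl = ∖-∉ w∈ (∈-self y)
      inside : ∀ {z} → z ∈ top → z ≢ w → z ∈ P₃ (T w)
      inside {z} z∈ z≢w with z ∈? P₃ (T w)
      ... | yes z∈C = z∈C
      ... | no z∉C = ⊥-elim (z≢w (top-missing w z∈ z∉C (∖-∈ (∖-∈ w∈)) (avoid₃ (T w))))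
    ... | no ¬p = ⊥-elim (<⇒≱ (s≤s 2≤r) (≤-trans (top-size (off-∈ˡ h))
            (≤-trans (#-∪ {S = ｛ x ｝} {｛ y ｝} {top} cover) (≤-reflexive (cong₂ _+_ (#-｛｝ x) (#-｛｝ y))))))
      where
      cover : ∀ {z} → z ∈ top → z ∈ ｛ x ｝ ⊎ z ∈ ｛ y ｝
      cover {z} z∈ with z ∈? ｛ x ｝ | z ∈? ｛ y ｝
      ... | yes s | _ = inj₁ s
      ... | no _ | yes t = inj₂ t
      ... | no s | no t = ⊥-elim (¬p (z , ∈-∖ (∈-∖ z∈ s) t))

    -- `P₁ (T w)` and `P₂ (T w)` are disjoint from `P₃ (T w)`, so they can meet the union only in
    -- its single vertex outside `P₃ (T w)`. One vertex spans no arc, hence deleting the arcs of the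
    -- union leaves both cliques intact.
    residual : ∀ w → Cliques (E ∖ off top) 0 p q w
    residual w = record
      { P₁ = ∅ ; P₂ = P₁ (T w) ; P₃ = P₂ (T w)
      ; size₁ = #-∅ {n} ; size₂ = size₁ (T w) ; size₃ = size₂ (T w)
      ; clique₁ = λ h → ⊥-elim (∉-∅ (off-∈ˡ h))
      ; clique₂ = λ h → ∈-∖ (clique₁ (T w) h) λ t → off-≢ h
          (top-missing w (off-∈ˡ t) (disjoint₁₃ (T w) (off-∈ˡ h)) (off-∈ʳ t) (disjoint₁₃ (T w) (off-∈ʳ h)))
      ; clique₃ = λ h → ∈-∖ (clique₂ (T w) h) λ t → off-≢ h
          (top-missing w (off-∈ˡ t) (disjoint₂₃ (T w) (off-∈ˡ h)) (off-∈ʳ t) (disjoint₂₃ (T w) (off-∈ʳ h)))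
      ; disjoint₁₂ = λ h → ⊥-elim (∉-∅ h)
      ; disjoint₁₃ = λ h → ⊥-elim (∉-∅ h)
      ; disjoint₂₃ = disjoint₁₂ (T w)
      ; avoid₁ = ∉-∅ ; avoid₂ = avoid₁ (T w) ; avoid₃ = avoid₂ (T w)
      }

  -- One round of the induction. `far` is the arithmetic for two largest cliques that overlap too
  -- little: a, b, c are the orders of the pieces into which the cliques of one family cut the other
  -- clique. `large` covers a union with at least r + 2 vertices. In the remaining case the union is
  -- a clique with at least r + 1 vertices, and `rec` bounds what is left after its removal.
  peel-top : Fin n → 2 ≤ r →
    (∀ {a b c} → a ≤ p → b ≤ q → c + 3 ≤ r → a + b + c ≤ r → arcs a + arcs b + arcs c + 2 * (p + q + r) ≤ arcs r) →
    (Close → 2 + r ≤ # top → arcs (suc p) + arcs (suc q) + arcs (suc r) ≤ ## E) →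
    (∀ {E′} → Symm E′ → Irreflexive E′ → (∀ w → Cliques E′ 0 p q w) → arcs (suc p) + arcs (suc q) ≤ ## E′) →
    arcs (suc p) + arcs (suc q) + arcs (suc r) ≤ ## E
  peel-top w₀ 2≤r far large rec with close?
  ... | inj₁ (w , w′ , h) = outside-bound (T w) (+-cancelˡ-≤ (arcs a + arcs b + arcs c) _ _ (begin
    arcs a + arcs b + arcs c + 2 * (p + q + r)            ≤⟨ far a≤ b≤ h (≤-trans (parts-≤ (T w) C′) (≤-reflexive (size₃ (T w′)))) ⟩
    arcs r                                                ≡⟨ cong arcs (size₃ (T w′)) ⟨
    arcs (# C′)                                           ≤⟨ clique-outside (T w) C′ (clique₃ (T w′)) ⟩
    arcs a + (arcs b + (arcs c + ## (outside (T w))))     ≡⟨ regroup (arcs a) (arcs b) (arcs c) _ ⟩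
    arcs a + arcs b + arcs c + ## (outside (T w))         ∎))
    where
    open ≤-Reasoning
    C′ = P₃ (T w′)
    a = # (C′ ∩ P₁ (T w))
    b = # (C′ ∩ P₂ (T w))
    c = # (C′ ∩ P₃ (T w))
    a≤ : a ≤ p
    a≤ = ≤-trans (#-mono ∩-∈ʳ) (≤-reflexive (size₁ (T w)))
    b≤ : b ≤ q
    b≤ = ≤-trans (#-mono ∩-∈ʳ) (≤-reflexive (size₂ (T w)))
    regroup : ∀ x y z t → x + (y + (z + t)) ≡ x + y + z + t
    regroup = solve-∀
  ... | inj₂ close with 2 + r ≤? # top
  ...   | yes h = large close h
  ...   | no h = ≤-trans (≤-reflexive (+-comm (arcs (suc p) + arcs (suc q)) (arcs (suc r))))
      (##-peel-≤ (top-clique 2≤r small) size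
        (rec (λ e → ∈-∖ (symm (∖-∈ e)) λ t → ∖-∉ e (∈-off (off-∈ʳ t) (off-∈ˡ t) (off-≢ t ∘ sym)))
             (irr ∘ ∖-∈) (residual 2≤r small)))
    where
    small : # top ≤ suc r
    small = s≤s⁻¹ (≰⇒> h)
    vertex : ∃ λ x → x ∈ P₃ (T w₀)
    vertex = #-pick (P₃ (T w₀)) (subst (1 ≤_) (sym (size₃ (T w₀))) (≤-trans (s≤s z≤n) 2≤r))
    size : arcs (suc r) ≤ ## (off top)
    size = ≤-trans (arcs-mono (top-size (∈-top w₀ (proj₂ vertex)))) (≤-reflexive (sym (##-off-arcs top)))

  top-two : ∀ w {k} → Close → r ≡ k + 2 → 2 + r ≤ # top → 2 * k + (2 * k + 0) ≤ ## (outside (T w))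
  top-two w {k} close e h = ≤-trans (+-mono-≤ ≤k (+-monoˡ-≤ 0 ≤k)) (bridge-count (T w) symm top (top-bridge close w e) z≤n)
    where
    ≤k : 2 * k ≤ # (top ∖ P₃ (T w)) * k
    ≤k = *-monoˡ-≤ k (top-excess w {2} h)

-- Arc bounds for families of one, two and three cliques

cliques-bound₁ : ∀ {E : Subset (Fin n × Fin n)} {p} → Fin n → 4 ≤ p → Symm E → Irreflexive E →
  (∀ w → Cliques E 0 0 p w) → arcs (suc p) ≤ ## E
cliques-bound₁ {E = E} {p} w₀ 4≤p symm irr T with m≤n⇒∃[o]m+o≡n 4≤p
... | i , refl = peel-top symm irr T w₀ (s≤s (s≤s z≤n)) far large λ _ _ _ → z≤n
  where
  far : ∀ {a b c} → a ≤ 0 → b ≤ 0 → c + 3 ≤ 4 + i → a + b + c ≤ 4 + i → arcs a + arcs b + arcs c + 2 * (4 + i) ≤ arcs (4 + i)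
  -- With a single nonempty piece the gain is 6p - 12. The general estimate 6p - 18 of `arcs-spread`
  -- would fall short of 2p for p = 4.
  far {c = c} z≤n z≤n c≤ _ = begin
    arcs c + 2 * (4 + i)       ≤⟨ +-monoˡ-≤ _ (arcs-mono (+-cancelʳ-≤ 3 c (1 + i) (≤-trans c≤ (≤-reflexive (+-comm 3 (1 + i)))))) ⟩
    arcs (1 + i) + 2 * (4 + i) ≤⟨ linear (4 + 4 * i) ≤-refl (certificate i) ⟩
    arcs (4 + i)               ∎
    where
    open ≤-Reasoning
    certificate : ∀ i → (1 + i) * i + 2 * (4 + i) + 0 + (4 + 4 * i) ≡ (4 + i) * (3 + i) + 0
    certificate = solve-∀
  large : Close symm irr T → 2 + (4 + i) ≤ # (top symm irr T) → arcs (5 + i) ≤ ## E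
  large close h = outside-bound (T w₀) (≤-trans (linear (2 * i) ≤-refl (certificate i)) (top-two symm irr T w₀ {2 + i} close (+-comm 2 (2 + i)) h))
    where
    certificate : ∀ i → 2 * (4 + i) + 0 + 2 * i ≡ 2 * (2 + i) + (2 * (2 + i) + 0) + 0
    certificate = solve-∀

cliques-bound₂ : ∀ {E : Subset (Fin n × Fin n)} {p q} → Fin n → 4 ≤ p → p + 4 ≤ q → Symm E → Irreflexive E →
  (∀ w → Cliques E 0 p q w) → arcs (suc p) + arcs (suc q) ≤ ## E
cliques-bound₂ {E = E} {p} {q} w₀ 4≤p p≤q symm irr T with m≤n⇒∃[o]m+o≡n 4≤p | m≤n⇒∃[o]m+o≡n p≤q
... | i , refl | j , refl = peel-top symm irr T w₀ (s≤s (s≤s z≤n)) far large (cliques-bound₁ w₀ 4≤p)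
  where
  far : ∀ {a b c} → a ≤ 0 → b ≤ p → c + 3 ≤ q → a + b + c ≤ q → arcs a + arcs b + arcs c + 2 * (p + q) ≤ arcs q
  far {a} {b} {c} z≤n b≤ c≤ sum≤ = linear (2 * i + 4 * j + 6)
    (arcs-spread {a} {b} {c} {q} (s≤s (s≤s (s≤s (s≤s z≤n)))) (s≤s (s≤s (s≤s z≤n)))
      (≤-trans (+-mono-≤ b≤ (s≤s (s≤s (s≤s (z≤n {1}))))) p≤q) c≤ sum≤)
    (certificate (arcs a + arcs b + arcs c) (arcs q) i j)
    where
    certificate : ∀ x y i j → x + 2 * (4 + i + (4 + i + 4 + j)) + (y + 18) + (2 * i + 4 * j + 6) ≡ y + (x + 6 * (4 + i + 4 + j))
    certificate = solve-∀
  large : Close symm irr T → 2 + q ≤ # (top symm irr T) → arcs (suc p) + arcs (suc q) ≤ ## E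
  -- Two extra vertices supply 4(q - 2) arcs, and this is at least 2(p + q) exactly when q ≥ p + 4.
  large close h = outside-bound (T w₀) (≤-trans (linear (2 * j) ≤-refl (certificate i j))
      (top-two symm irr T w₀ {6 + i + j} close (identity i j) h))
    where
    identity : ∀ i j → 4 + i + 4 + j ≡ 6 + i + j + 2
    identity = solve-∀
    certificate : ∀ i j → 2 * (0 + (4 + i) + (4 + i + 4 + j)) + 0 + 2 * j ≡ 2 * (6 + i + j) + (2 * (6 + i + j) + 0) + 0
    certificate = solve-∀

cliques-bound₃ : ∀ {E : Subset (Fin n × Fin n)} {p q r} → Fin n → 4 ≤ p → p + 4 ≤ q → q + 4 ≤ r → Symm E → Irreflexive E →
  (∀ w → Cliques E p q r w) → arcs (suc p) + arcs (suc q) + arcs (suc r) ≤ ## E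
cliques-bound₃ {n = n} {E = E} {p} {q} {r} w₀ 4≤p p≤q q≤r symm irr T
  with m≤n⇒∃[o]m+o≡n 4≤p | m≤n⇒∃[o]m+o≡n p≤q | m≤n⇒∃[o]m+o≡n q≤r
... | i , refl | j , refl | t , refl = peel-top symm irr T w₀ (s≤s (s≤s z≤n)) far large (cliques-bound₂ w₀ 4≤p p≤q)
  where
  far : ∀ {a b c} → a ≤ p → b ≤ q → c + 3 ≤ r → a + b + c ≤ r → arcs a + arcs b + arcs c + 2 * (p + q + r) ≤ arcs r
  far {a} {b} {c} a≤ b≤ c≤ sum≤ = linear (2 * j + 4 * t + 6)
    (arcs-spread {a} {b} {c} {r} (s≤s (s≤s (s≤s (s≤s z≤n))))
      (≤-trans (+-mono-≤ a≤ (s≤s (s≤s (s≤s (z≤n {1}))))) (≤-trans p≤q (≤-trans (m≤m+n q 4) q≤r)))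
      (≤-trans (+-mono-≤ b≤ (s≤s (s≤s (s≤s (z≤n {1}))))) q≤r) c≤ sum≤)
    (certificate (arcs a + arcs b + arcs c) (arcs r) i j t)
    where
    certificate : ∀ x y i j t → x + 2 * (4 + i + (4 + i + 4 + j) + (4 + i + 4 + j + 4 + t)) + (y + 18) + (2 * j + 4 * t + 6)
      ≡ y + (x + 6 * (4 + i + 4 + j + 4 + t))
    certificate = solve-∀
  U = top symm irr T
  d = 10 + i + j + t
  r≡ : r ≡ d + 2
  r≡ = identity i j t
    where
    identity : ∀ i j t → 4 + i + 4 + j + 4 + t ≡ 10 + i + j + t + 2
    identity = solve-∀
  large : Close symm irr T → 2 + r ≤ # U → arcs (suc p) + arcs (suc q) + arcs (suc r) ≤ ## E
  -- Three extra vertices supply 6(r - 2) arcs, which is enough. Two supply only 4(r - 2), which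
  -- need not reach 2(p + q + r); then a star with 2(q - 1) arcs makes up the difference, by r ≥ p +
  -- 8.
  large close h with 3 + r ≤? # U
  ... | yes h₃ = outside-bound (T w₀) (≤-trans (linear (12 + 2 * j + 4 * t) ≤-refl (certificate i j t))
      (≤-trans (+-mono-≤ ≤d (+-monoˡ-≤ 0 ≤d)) (bridge-count (T w₀) symm U (top-bridge symm irr T close w₀ r≡) z≤n)))
    where
    ≤d : 3 * d ≤ # (U ∖ P₃ (T w₀)) * d
    ≤d = *-monoˡ-≤ d (top-excess symm irr T w₀ {3} h₃)
    certificate : ∀ i j t → 2 * (4 + i + (4 + i + 4 + j) + (4 + i + 4 + j + 4 + t)) + 0 + (12 + 2 * j + 4 * t)
      ≡ 3 * (10 + i + j + t) + (3 * (10 + i + j + t) + 0) + 0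
    certificate = solve-∀
  -- U then misses most of a q-clique, and a vertex u of that clique outside U
  -- contributes its q - 1 neighbours to the count relative to T u.
  ... | no h₃ = outside-bound (T u) (≤-trans (linear (6 + 2 * j + 2 * t) ≤-refl (certificate i j t))
      (≤-trans (+-mono-≤ ≤d (+-monoˡ-≤ (s + s) ≤d)) (bridge-count (T u) symm U (top-bridge symm irr T close u r≡)
        (star-count (T u) symm U irr u∉U (avoid₁ (T u)) (avoid₂ (T u)) (avoid₃ (T u)) degree))))
    where
    ≤d : ∀ {w} → 2 * d ≤ # (U ∖ P₃ (T w)) * d
    ≤d {w} = *-monoˡ-≤ d (top-excess symm irr T w {2} h)
    s = 7 + i + j
    K = P₂ (T w₀)
    few : # (U ∖ P₃ (T w₀)) ≤ 2
    few = +-cancelˡ-≤ r _ 2 (≤-trans (≤-reflexive (trans (cong (_+ # (U ∖ P₃ (T w₀))) (sym (size₃ (T w₀)))) (sym (#-peel (∈-top symm irr T w₀)))))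
            (≤-trans (s≤s⁻¹ (≰⇒> h₃)) (≤-reflexive (+-comm 2 r))))
    chosen : ∃ λ u → u ∈ K × u ∉ U ∖ P₃ (T w₀)
    chosen = #-pick-∖ (U ∖ P₃ (T w₀)) K (≤-trans (s≤s few) (≤-trans (s≤s (s≤s (s≤s z≤n))) (≤-reflexive (sym (size₂ (T w₀))))))
    u = proj₁ chosen
    u∈K = proj₁ (proj₂ chosen)
    u∉U : u ∉ U
    u∉U u∈U = proj₂ (proj₂ chosen) (∈-∖ u∈U (disjoint₂₃ (T w₀) u∈K))
    degree : s ≤ # (row E u)
    degree = ≤-trans (+-cancelˡ-≤ 1 s (# (K ∖ ｛ u ｝)) (≤-reflexive (trans (identity i j) (trans (sym (size₂ (T w₀)))
               (trans (#-peel (λ e → subst (_∈ K) (∈-｛｝ e) u∈K)) (cong (_+ # (K ∖ ｛ u ｝)) (#-｛｝ u)))))))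
               (#-mono λ h → ∈-row (clique₂ (T w₀) (∈-off u∈K (∖-∈ h) λ { refl → ∖-∉ h (∈-self u) })))
      where
      identity : ∀ i j → 1 + (7 + i + j) ≡ 4 + i + 4 + j
      identity = solve-∀
    certificate : ∀ i j t → 2 * (4 + i + (4 + i + 4 + j) + (4 + i + 4 + j + 4 + t)) + 0 + (6 + 2 * j + 2 * t)
      ≡ 2 * (10 + i + j + t) + (2 * (10 + i + j + t) + (7 + i + j + (7 + i + j))) + 0
    certificate = solve-∀

-- Consecutive blocks

opaque
  fiber : (Fin n → ℕ) → ℕ → Subset (Fin n)
  fiber f k x = f x ≡ᵇ k

≡ᵇ-≡ : ∀ {k l} → (k ≡ᵇ l) ≡ true → k ≡ l
≡ᵇ-≡ {k} {l} h = ≡ᵇ⇒≡ k l (subst T (sym h) _)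

≡-≡ᵇ : ∀ {k l} → k ≡ l → (k ≡ᵇ l) ≡ true
≡-≡ᵇ {k} {l} = dec-true (ℕ._≟_ k l)

opaque
  unfolding fiber

  ∈-fiber : ∀ {f : Fin n → ℕ} {k x} → f x ≡ k → x ∈ fiber f k
  ∈-fiber e = ∈-intro (≡-≡ᵇ e)

  fiber-∈ : ∀ {f : Fin n → ℕ} {k x} → x ∈ fiber f k → f x ≡ k
  fiber-∈ h = ≡ᵇ-≡ (∈-elim h)

#-cong : {S R : Subset (Fin n)} → S ⊆ R → R ⊆ S → # S ≡ # R
#-cong S⊆R R⊆S = ≤-antisym (#-mono S⊆R) (#-mono R⊆S)

#-all : {S : Subset (Fin n)} → (∀ x → x ∈ S) → # S ≡ n
#-all {n} h = trans (#-cong (λ _ → ∈-full) (λ _ → h _)) (#-full {n})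

sum-↑ : ∀ m (f : Fin (m + n) → ℕ) → sum f ≡ sum (λ x → f (x ↑ˡ n)) + sum (λ x → f (m ↑ʳ x))
sum-↑ zero f = refl
sum-↑ (suc m) f = trans (cong (f zero +_) (sum-↑ m (f ∘ suc))) (sym (+-assoc (f zero) _ _))

opaque
  unfolding # fiber

  #-fiber-↑ : ∀ m (f : Fin (m + n) → ℕ) k → # (fiber f k) ≡ # (fiber (f ∘ (_↑ˡ n)) k) + # (fiber (f ∘ (m ↑ʳ_)) k)
  #-fiber-↑ m f k = sum-↑ m (λ x → ⟦ f x ≡ᵇ k ⟧)

blockOf-< : ∀ {p} ps {v} → v < p → blockOf (p ∷ ps) v ≡ 0
blockOf-< {p} ps {v} v<p rewrite dec-true (v <? p) v<p = refl

blockOf-≥ : ∀ p ps v → blockOf (p ∷ ps) (p + v) ≡ suc (blockOf ps v)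
blockOf-≥ p ps v rewrite dec-false (p + v <? p) (m+n≮m p v) | m+n∸m≡n p v = refl

nth : List ℕ → ℕ → ℕ
nth [] _ = 0
nth (p ∷ _) zero = p
nth (_ ∷ ps) (suc k) = nth ps k

-- The positions past the last block act as one more block of size `r`, hence the appended entry.
block-size : ∀ ps r → n ≡ total ps + r → ∀ k → # (fiber (blockOf ps ∘ toℕ {n}) k) ≡ nth (ps ∷ʳ r) k
block-size [] r refl zero = #-all λ x → ∈-fiber refl
block-size [] r refl (suc k) = #-∅-≤ λ h → 0≢1+n (fiber-∈ h)
block-size (p ∷ ps) r refl k rewrite +-assoc p (total ps) r = trans (#-fiber-↑ p _ k) (halves k)
  where
  f : Fin (p + (total ps + r)) → ℕ
  f = blockOf (p ∷ ps) ∘ toℕ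
  left : ∀ x → f (x ↑ˡ (total ps + r)) ≡ 0
  left x = blockOf-< ps (subst (_< p) (sym (toℕ-↑ˡ x (total ps + r))) (toℕ<n x))
  right : ∀ x → f (p ↑ʳ x) ≡ suc (blockOf ps (toℕ x))
  right x = trans (cong (blockOf (p ∷ ps)) (toℕ-↑ʳ p x)) (blockOf-≥ p ps (toℕ x))
  halves : ∀ k → # (fiber (f ∘ (_↑ˡ (total ps + r))) k) + # (fiber (f ∘ (p ↑ʳ_)) k) ≡ nth (p ∷ (ps ∷ʳ r)) k
  halves zero = trans (cong₂ _+_ (#-all λ x → ∈-fiber {f = f ∘ (_↑ˡ (total ps + r))} (left x))
    (#-∅-≤ λ {x} h → 0≢1+n (trans (sym (fiber-∈ {f = f ∘ (p ↑ʳ_)} h)) (right x)))) (+-identityʳ p)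
  halves (suc k) = trans (cong₂ _+_ (#-∅-≤ λ {x} h → 0≢1+n (trans (sym (left x)) (fiber-∈ {f = f ∘ (_↑ˡ (total ps + r))} h)))
    (#-cong {R = fiber (blockOf ps ∘ toℕ) k}
      (λ {x} h → ∈-fiber (suc-injective (trans (sym (right x)) (fiber-∈ {f = f ∘ (p ↑ʳ_)} h))))
      (λ {x} h → ∈-fiber {f = f ∘ (p ↑ʳ_)} (trans (right x) (cong suc (fiber-∈ h)))))) (block-size ps r refl k)

-- Copies of a disjoint union of cliques

opaque
  image : (Fin m → Fin n) → Subset (Fin m) → Subset (Fin n)
  image f S y = does (any? λ x → (x ∈? S) ×-dec (f x ≟ y))

opaque
  unfolding image

  ∈-image : ∀ {f : Fin m → Fin n} {S x} → x ∈ S → f x ∈ image f S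
  ∈-image {f = f} {S} {x} x∈ = ∈-intro (dec-true (any? λ z → (z ∈? S) ×-dec (f z ≟ f x)) (x , x∈ , refl))

  image-∈ : ∀ {f : Fin m → Fin n} {S y} → y ∈ image f S → ∃ λ x → x ∈ S × f x ≡ y
  image-∈ {f = f} {S} {y} h with any? (λ x → (x ∈? S) ×-dec (f x ≟ y)) | ∈-elim h
  ... | yes p | _ = p
  ... | no _ | ()

opaque
  unfolding # _∈_

  -- Double counting of the pairs (x, f x) with x in `S`: each row of `S` holds one pair, and by
  -- injectivity so does each column of the image.
  #-image : ∀ {f : Fin m → Fin n} → Injective _≡_ _≡_ f → (S : Subset (Fin m)) → # (image f S) ≡ # S
  #-image {m} {n} {f} inj S = sym (begin
    sum (λ x → ⟦ S x ⟧)                                ≡⟨ sum-cong-≗ (λ x → *-identityʳ ⟦ S x ⟧) ⟨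
    sum (λ x → ⟦ S x ⟧ * 1)                            ≡⟨ sum-cong-≗ (λ x → trans (#-scale (S x) ｛ f x ｝) (cong (⟦ S x ⟧ *_) (#-｛｝ (f x)))) ⟨
    sum (λ x → sum (λ y → ⟦ S x ∧ ｛ f x ｝ y ⟧))        ≡⟨ ∑-comm (λ x y → ⟦ S x ∧ ｛ f x ｝ y ⟧) ⟩
    sum (λ y → # (preimage y))                         ≡⟨ sum-cong-≗ single ⟩
    # (image f S)                                      ∎)
    where
    open ≡-Reasoning
    preimage : Fin n → Subset (Fin m)
    preimage y x = S x ∧ ｛ f x ｝ y
    single : ∀ y → # (preimage y) ≡ ⟦ image f S y ⟧
    single y with y ∈? image f S
    ... | yes y∈ with x , x∈ , refl ← image-∈ {f = f} {S} {y} y∈ =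
      trans (#-cong {S = preimage y} {｛ x ｝} unique exists) (trans (#-｛｝ x) (cong ⟦_⟧ (sym y∈)))
      where
      unique : preimage y ⊆ ｛ x ｝
      unique {z} h = subst (_∈ ｛ x ｝) (inj (sym (∈-｛｝ {x = f z} {y} (∧-trueʳ {S z} h)))) (∈-self x)
      exists : ｛ x ｝ ⊆ preimage y
      exists {z} h = subst (_∈ preimage y) (∈-｛｝ {x = x} {z} h) (∧-true {S x} x∈ (∈-self (f x)))
    ... | no y∉ = trans (#-∅-≤ {S = preimage y} λ {x} h → y∉ (subst (_∈ image f S) (∈-｛｝ {x = f x} {y} (∧-trueʳ {S x} h)) (∈-image {f = f} {S} {x} (∧-trueˡ h))))
                        (cong ⟦_⟧ (sym (∉⇒false {S = image f S} {y} y∉)))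

opaque
  unfolding #

  #-suc : (S : Subset (Fin (suc n))) → # S ≡ ⟦ S zero ⟧ + # (S ∘ suc)
  #-suc S = refl

opaque
  unfolding _∈_

  ∈-suc : {S : Subset (Fin (suc n))} {x : Fin n} → suc x ∈ S → x ∈ S ∘ suc
  ∈-suc h = h

embed : (P : Subset (Fin m)) (S : Subset (Fin n)) → # P ≤ # S →
  Σ (∀ x → x ∈ P → Fin n) λ g → (∀ {x} h → g x h ∈ S) × (∀ {x y} h h′ → g x h ≡ g y h′ → x ≡ y)
embed {zero} P S le = (λ ()) , (λ { {()} }) , (λ { {()} })
embed {suc m} {n} P S le with zero ∈? P
... | no z∉ = g , g∈ , g-inj
  where
  rest = embed (P ∘ suc) S (≤-trans (≤-reflexive (sym (trans (#-suc P) (cong (λ b → ⟦ b ⟧ + # (P ∘ suc)) (∉⇒false z∉))))) le)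
  g : ∀ x → x ∈ P → Fin n
  g zero h = ⊥-elim (z∉ h)
  g (suc x) h = proj₁ rest x (∈-suc h)
  g∈ : ∀ {x} h → g x h ∈ S
  g∈ {zero} h = ⊥-elim (z∉ h)
  g∈ {suc x} h = proj₁ (proj₂ rest) (∈-suc h)
  g-inj : ∀ {x y} h h′ → g x h ≡ g y h′ → x ≡ y
  g-inj {zero} h h′ e = ⊥-elim (z∉ h)
  g-inj {suc x} {zero} h h′ e = ⊥-elim (z∉ h′)
  g-inj {suc x} {suc y} h h′ e = cong suc (proj₂ (proj₂ rest) (∈-suc h) (∈-suc h′) e)
... | yes z∈ = g , g∈ , g-inj
  where
  sizeP : suc (# (P ∘ suc)) ≡ # P
  sizeP = sym (trans (#-suc P) (cong (λ b → ⟦ b ⟧ + # (P ∘ suc)) (∈-elim z∈)))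
  first : ∃ λ s → s ∈ S
  first = #-pick S (≤-trans (s≤s z≤n) (≤-trans (≤-reflexive sizeP) le))
  s = proj₁ first
  s∈ = proj₂ first
  rest = embed (P ∘ suc) (S ∖ ｛ s ｝) (s≤s⁻¹ (≤-trans (≤-reflexive sizeP) (≤-trans le (≤-reflexive
    (trans (#-peel λ e → subst (_∈ S) (∈-｛｝ e) s∈) (cong (_+ # (S ∖ ｛ s ｝)) (#-｛｝ s)))))))
  g : ∀ x → x ∈ P → Fin n
  g zero h = s
  g (suc x) h = proj₁ rest x (∈-suc h)
  ≢s : ∀ {x} h → proj₁ rest x h ≢ s
  ≢s h e = ∖-∉ (proj₁ (proj₂ rest) h) (subst (_∈ ｛ s ｝) (sym e) (∈-self s))
  g∈ : ∀ {x} h → g x h ∈ S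
  g∈ {zero} h = s∈
  g∈ {suc x} h = ∖-∈ (proj₁ (proj₂ rest) (∈-suc h))
  g-inj : ∀ {x y} h h′ → g x h ≡ g y h′ → x ≡ y
  g-inj {zero} {zero} h h′ e = refl
  g-inj {zero} {suc y} h h′ e = ⊥-elim (≢s (∈-suc h′) (sym e))
  g-inj {suc x} {zero} h h′ e = ⊥-elim (≢s (∈-suc h) e)
  g-inj {suc x} {suc y} h h′ e = cong suc (proj₂ (proj₂ rest) (∈-suc h) (∈-suc h′) e)

-- A copy of a union of cliques with the naming of its vertices forgotten. Sizes are kept apart: a
-- copy gives parts of the exact orders, while parts that are too large still give a copy.
record Packing (E : Subset (Fin n × Fin n)) : Set where
  field
    part : ℕ → Subset (Fin n)
    clique : ∀ {k} → off (part k) ⊆ E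
    disjoint : ∀ {k l x} → x ∈ part k → x ∈ part l → k ≡ l
open Packing

module _ (p₁ p₂ p₃ p₄ : ℕ) where

  F : Graph (p₁ + p₂ + p₃ + p₄)
  F = K4union p₁ p₂ p₃ p₄

  orders : ℕ → ℕ
  orders = nth (p₁ ∷ p₂ ∷ p₃ ∷ p₄ ∷ 0 ∷ [])

  block : Fin (p₁ + p₂ + p₃ + p₄) → ℕ
  block x = blockOf (p₁ ∷ p₂ ∷ p₃ ∷ p₄ ∷ []) (toℕ x)

  #-block : ∀ k → # (fiber block k) ≡ orders k
  #-block = block-size (p₁ ∷ p₂ ∷ p₃ ∷ p₄ ∷ []) 0 (identity p₁ p₂ p₃ p₄)
    where
    identity : ∀ a b c d → a + b + c + d ≡ a + (b + (c + (d + 0))) + 0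
    identity = solve-∀

  F-adj : ∀ {x y} → x ≢ y → block x ≡ block y → Adj F x y ≡ true
  F-adj {x} {y} x≢y e = ∧-true (cong not (dec-false (ℕ._≟_ (toℕ x) (toℕ y)) (x≢y ∘ toℕ-injective))) (≡-≡ᵇ e)

  adj-F : ∀ {x y} → Adj F x y ≡ true → x ≢ y × block x ≡ block y
  adj-F {x} {y} h = (λ { refl → false≢true (∧-trueˡ {not (toℕ x ≡ᵇ toℕ x)} h) }) , ≡ᵇ-≡ (∧-trueʳ {not (toℕ x ≡ᵇ toℕ y)} h)
    where
    false≢true : not (toℕ x ≡ᵇ toℕ x) ≢ true
    false≢true p with () ← trans (sym (cong not (≡-≡ᵇ {toℕ x} refl))) p

  copy⇒packing : ∀ {A : Fin n → Fin n → Bool} → ContainsAdj A F → Packing (uncurry A)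
  copy⇒packing {A = A} (f , inj , adj) = record
    { part = λ k → image f (fiber block k)
    ; clique = λ {k} {(u , v)} h → clique′ (image-∈ (off-∈ˡ h)) (image-∈ (off-∈ʳ h)) (off-≢ h)
    ; disjoint = λ u∈ u∈′ → disjoint′ (image-∈ u∈) (image-∈ u∈′)
    }
    where
    clique′ : ∀ {k u v} → (∃ λ x → x ∈ fiber block k × f x ≡ u) → (∃ λ y → y ∈ fiber block k × f y ≡ v) → u ≢ v → (u , v) ∈ uncurry A
    clique′ (x , x∈ , refl) (y , y∈ , refl) u≢v =
      ∈-intro (adj x y (F-adj (λ { refl → u≢v refl }) (trans (fiber-∈ x∈) (sym (fiber-∈ y∈)))))
    disjoint′ : ∀ {k l u} → (∃ λ x → x ∈ fiber block k × f x ≡ u) → (∃ λ y → y ∈ fiber block l × f y ≡ u) → k ≡ l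
    disjoint′ (x , x∈ , refl) (y , y∈ , e) = trans (sym (fiber-∈ x∈)) (trans (cong block (inj (sym e))) (fiber-∈ y∈))

  copy⇒packing-size : ∀ {A : Fin n → Fin n → Bool} (c : ContainsAdj A F) k → # (part (copy⇒packing {A = A} c) k) ≡ orders k
  copy⇒packing-size (f , inj , adj) k = trans (#-image inj (fiber block k)) (#-block k)

  packing⇒copy : ∀ {A : Fin n → Fin n → Bool} (P : Packing (uncurry A)) → (∀ k → orders k ≤ # (part P k)) → ContainsAdj A F
  packing⇒copy {n} {A} P sizes = f , inj , adj
    where
    emb = λ k → embed (fiber block k) (part P k) (≤-trans (≤-reflexive (#-block k)) (sizes k))
    f : Fin (p₁ + p₂ + p₃ + p₄) → Fin n
    f x = proj₁ (emb (block x)) x (∈-fiber refl)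
    f∈ : ∀ x → f x ∈ part P (block x)
    f∈ x = proj₁ (proj₂ (emb (block x))) (∈-fiber refl)
    inj′ : ∀ {k l x y} (h : x ∈ fiber block k) (h′ : y ∈ fiber block l) → k ≡ l → proj₁ (emb k) x h ≡ proj₁ (emb l) y h′ → x ≡ y
    inj′ {k} h h′ refl e = proj₂ (proj₂ (emb k)) h h′ e
    inj : Injective _≡_ _≡_ f
    inj {x} {y} e = inj′ (∈-fiber refl) (∈-fiber refl) (disjoint P (f∈ x) (subst (_∈ part P (block y)) (sym e) (f∈ y))) e
    adj : ∀ x y → Adj F x y ≡ true → A (f x) (f y) ≡ true
    adj x y h with adj-F h
    ... | x≢y , e = ∈-elim (clique P (∈-off (subst (λ k → f x ∈ part P k) e (f∈ x)) (f∈ y) (x≢y ∘ inj)))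

opaque
  infixl 6 _∪_
  _∪_ : Subset A → Subset A → Subset A
  (S ∪ R) x = S x ∨ R x

opaque
  unfolding _∪_ _∈_

  ∈-∪ˡ : ∀ {x : A} → x ∈ S → x ∈ S ∪ R
  ∈-∪ˡ {R = R} {x} h = cong (_∨ R x) h

  ∈-∪ʳ : ∀ {x : A} → x ∈ R → x ∈ S ∪ R
  ∈-∪ʳ {S = S} {x = x} h = trans (cong (S x ∨_) h) (Bool.∨-zeroʳ (S x))

  ∪-∈ : ∀ {x : A} → x ∈ S ∪ R → x ∈ S ⊎ x ∈ R
  ∪-∈ {S = S} {x = x} h with S x
  ... | true = inj₁ refl
  ... | false = inj₂ h

-- Edges as pairs of opposite arcs

arcsOf : Graph n → Subset (Fin n × Fin n)
arcsOf G = uncurry (Adj G)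

arcsOf-symm : (G : Graph n) → Symm (arcsOf G)
arcsOf-symm G {x} {y} h = ∈-intro (trans (adj-sym G y x) (∈-elim h))

arcsOf-irr : (G : Graph n) → Irreflexive (arcsOf G)
arcsOf-irr G {x} h with () ← trans (sym (adj-irrefl G x)) (∈-elim h)

total-tabulate : (f : Fin n → ℕ) → total (tabulate f) ≡ sum f
total-tabulate {zero} f = refl
total-tabulate {suc n} f = cong (f zero +_) (total-tabulate (f ∘ suc))

total-allFin : (f : Fin n → ℕ) → total (map f (allFin n)) ≡ sum f
total-allFin f = trans (cong total (map-tabulate (λ x → x) f)) (total-tabulate f)

##-cong : {S R : Subset (Fin n × Fin m)} → S ⊆ R → R ⊆ S → ## S ≡ ## R
##-cong S⊆R R⊆S = ≤-antisym (##-mono S⊆R) (##-mono R⊆S)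

opaque
  unfolding ##

  edges-## : (G : Graph n) → edges G ≡ ## (uncurry λ x y → (toℕ x <ᵇ toℕ y) ∧ Adj G x y)
  edges-## {n} G = trans (total-allFin (λ x → total (map (up x) (allFin n)))) (sum-cong-≗ λ x → total-allFin (up x))
    where
    up : Fin n → Fin n → ℕ
    up x y = ⟦ (toℕ x <ᵇ toℕ y) ∧ Adj G x y ⟧

handshake : (G : Graph n) → ## (arcsOf G) ≡ 2 * edges G
handshake {n} G = begin
  ## (arcsOf G)                           ≡⟨ ##-peel {S = up} up⊆ ⟩
  ## up + ## (arcsOf G ∖ up)              ≡⟨ cong (## up +_) (trans (##-cong down⊆ down⊇) (##-ᵀ up)) ⟩
  ## up + ## up                           ≡⟨ cong (## up +_) (+-identityʳ _) ⟨
  2 * ## up                               ≡⟨ cong (2 *_) (edges-## G) ⟨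
  2 * edges G                             ∎
  where
  open ≡-Reasoning
  up : Subset (Fin n × Fin n)
  up = uncurry λ x y → (toℕ x <ᵇ toℕ y) ∧ Adj G x y
  ∈-up : ∀ {x y} → toℕ x < toℕ y → (x , y) ∈ arcsOf G → (x , y) ∈ up
  ∈-up {x} {y} lt h = ∈-intro (∧-true (dec-true (toℕ x <? toℕ y) lt) (∈-elim h))
  up⊆ : up ⊆ arcsOf G
  up⊆ {x , y} h = ∈-intro (∧-trueʳ {toℕ x <ᵇ toℕ y} (∈-elim h))
  up-< : ∀ {x y} → (x , y) ∈ up → toℕ x < toℕ y
  up-< {x} {y} h = <ᵇ⇒< (toℕ x) (toℕ y) (subst T (sym (∧-trueˡ {toℕ x <ᵇ toℕ y} (∈-elim h))) _)
  down⊆ : arcsOf G ∖ up ⊆ up ᵀ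
  down⊆ {x , y} h = ∈-ᵀ {R = up} (∈-up (≤∧≢⇒< (≮⇒≥ λ lt → ∖-∉ h (∈-up lt (∖-∈ h)))
    λ e → arcsOf-irr G {x} (subst (λ z → (x , z) ∈ arcsOf G) (toℕ-injective e) (∖-∈ h))) (arcsOf-symm G (∖-∈ h)))
  down⊇ : up ᵀ ⊆ arcsOf G ∖ up
  down⊇ {x , y} h = ∈-∖ (arcsOf-symm G (up⊆ (ᵀ-∈ {R = up} h))) λ h′ → <-asym (up-< h′) (up-< (ᵀ-∈ {R = up} h))

arcs-C : ∀ m → 2 * (m C 2) ≡ arcs m
arcs-C zero = refl
arcs-C (suc m) = begin
  2 * (suc m C 2)         ≡⟨ cong (2 *_) (nCk+nC[k+1]≡[n+1]C[k+1] m 1) ⟨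
  2 * (m C 1 + m C 2)     ≡⟨ *-distribˡ-+ 2 (m C 1) (m C 2) ⟩
  2 * (m C 1) + 2 * (m C 2) ≡⟨ cong₂ _+_ (cong (2 *_) (nC1≡n m)) (arcs-C m) ⟩
  2 * m + arcs m          ≡⟨ +-comm (2 * m) _ ⟩
  arcs m + 2 * m          ≡⟨ arcs-suc m ⟨
  arcs (suc m)            ∎
  where open ≡-Reasoning

module _ (G : Graph n) (u v : Fin n) where

  addEdge-old : ∀ {x y} → (x , y) ∈ arcsOf G → (x , y) ∈ uncurry (addEdge G u v)
  addEdge-old h = ∈-intro (cong (_∨ _) (∈-elim h))

  addEdge-uv : (u , v) ∈ uncurry (addEdge G u v)
  addEdge-uv = ∈-intro holds
    where
    holds : addEdge G u v u v ≡ true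
    holds rewrite ≡-≡ᵇ {toℕ u} refl | ≡-≡ᵇ {toℕ v} refl = Bool.∨-zeroʳ (Adj G u v)

  addEdge-vu : (v , u) ∈ uncurry (addEdge G u v)
  addEdge-vu = ∈-intro holds
    where
    holds : addEdge G u v v u ≡ true
    holds rewrite ≡-≡ᵇ {toℕ u} refl | ≡-≡ᵇ {toℕ v} refl =
      trans (cong (Adj G v u ∨_) (Bool.∨-zeroʳ ((toℕ v ≡ᵇ toℕ u) ∧ (toℕ u ≡ᵇ toℕ v)))) (Bool.∨-zeroʳ (Adj G v u))

  addEdge-new : ∀ {x y} → addEdge G u v x y ≡ true →
    Adj G x y ≡ true ⊎ (x ≡ u × y ≡ v) ⊎ (x ≡ v × y ≡ u)
  addEdge-new {x} {y} h with Adj G x y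
  ... | true = inj₁ refl
  ... | false with (toℕ x ≡ᵇ toℕ u) ∧ (toℕ y ≡ᵇ toℕ v) in e
  ...   | true = inj₂ (inj₁ (toℕ-injective (≡ᵇ-≡ (∧-trueˡ e)) , toℕ-injective (≡ᵇ-≡ (∧-trueʳ {toℕ x ≡ᵇ toℕ u} e))))
  ...   | false = inj₂ (inj₂ (toℕ-injective (≡ᵇ-≡ (∧-trueˡ h)) , toℕ-injective (≡ᵇ-≡ (∧-trueʳ {toℕ x ≡ᵇ toℕ v} h))))

-- The graph H(n; p₁, p₂, p₃, p₄)

-- Adjacency of distinct vertices of H, read off their classes. The bound 4 excludes the edgeless
-- class; it is one more than the bound in `Hgraph` because the dominating clique is class 0 here.
Linked : ℕ → ℕ → Set
Linked k l = k ≡ 0 ⊎ l ≡ 0 ⊎ (k ≡ l × k < 4)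

module _ (n p₁ p₂ p₃ p₄ : ℕ) where

  H : Graph n
  H = Hgraph n p₁ p₂ p₃ p₄

  -- Class 0 is the dominating clique, classes 1, 2, 3 are the cliques of
  -- order pᵢ + 1, and class 4 consists of the remaining vertices.
  class : Fin n → ℕ
  class x = blockOf (p₁ ∸ 2 ∷ suc p₂ ∷ suc p₃ ∷ suc p₄ ∷ []) (toℕ x)

  private
    linked : ∀ b c k l → (b ∨ c ∨ ((k ≡ᵇ l) ∧ (k <ᵇ 3))) ≡ true →
      Linked (if b then 0 else suc k) (if c then 0 else suc l)
    linked true c k l h = inj₁ refl
    linked false true k l h = inj₂ (inj₁ refl)
    linked false false k l h = inj₂ (inj₂ (cong suc (≡ᵇ-≡ (∧-trueˡ h)) ,
      s≤s (<ᵇ⇒< k 3 (subst T (sym (∧-trueʳ {k ≡ᵇ l} h)) _))))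

    linked⁻¹ : ∀ b c k l → Linked (if b then 0 else suc k) (if c then 0 else suc l) →
      (b ∨ c ∨ ((k ≡ᵇ l) ∧ (k <ᵇ 3))) ≡ true
    linked⁻¹ true c k l h = refl
    linked⁻¹ false true k l h = refl
    linked⁻¹ false false k l (inj₂ (inj₂ (refl , s≤s k<3))) = ∧-true (≡-≡ᵇ {k} refl) (dec-true (k <? 3) k<3)

  H-linked : ∀ {x y} → (x , y) ∈ arcsOf H → Linked (class x) (class y)
  H-linked {x} {y} h = linked (toℕ x <ᵇ p₁ ∸ 2) _ _ _ (∧-trueʳ {not (toℕ x ≡ᵇ toℕ y)} (∈-elim h))

  linked-H : ∀ {x y} → x ≢ y → Linked (class x) (class y) → (x , y) ∈ arcsOf H
  linked-H {x} {y} x≢y h = ∈-intro (∧-true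
    (cong not (dec-false (ℕ._≟_ (toℕ x) (toℕ y)) (x≢y ∘ toℕ-injective)))
    (linked⁻¹ (toℕ x <ᵇ p₁ ∸ 2) _ _ _ h))

module _ (n p₁ p₂ p₃ p₄ : ℕ) (big : total (p₁ ∸ 2 ∷ suc p₂ ∷ suc p₃ ∷ suc p₄ ∷ []) ≤ n) where

  private
    a = p₁ ∸ 2
    E = arcsOf (H n p₁ p₂ p₃ p₄)
    κ = class n p₁ p₂ p₃ p₄
    K : ℕ → Subset (Fin n)
    K = fiber κ
    size : ℕ → ℕ
    size = nth (a ∷ suc p₂ ∷ suc p₃ ∷ suc p₄ ∷ [])
    link : ∀ {x y} → x ≢ y → Linked (κ x) (κ y) → (x , y) ∈ E
    link = linked-H n p₁ p₂ p₃ p₄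
    linked : ∀ {x y} → (x , y) ∈ E → Linked (κ x) (κ y)
    linked = H-linked n p₁ p₂ p₃ p₄

    #-K : ∀ {k} → k < 4 → # (K k) ≡ size k
    #-K {k} k<4 = trans (block-size ps (n ∸ total ps) (sym (m+[n∸m]≡n big)) k) (inner k {n ∸ total ps} k<4)
      where
      ps = a ∷ suc p₂ ∷ suc p₃ ∷ suc p₄ ∷ []
      inner : ∀ k {r} → k < 4 → nth (a ∷ suc p₂ ∷ suc p₃ ∷ suc p₄ ∷ r ∷ []) k ≡ size k
      inner 0 _ = refl
      inner 1 _ = refl
      inner 2 _ = refl
      inner 3 _ = refl
      inner (suc (suc (suc (suc k)))) (s≤s (s≤s (s≤s (s≤s ()))))

    K-unique : ∀ {k l x} → x ∈ K k → x ∈ K l → k ≡ l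
    K-unique h h′ = trans (sym (fiber-∈ h)) (fiber-∈ h′)

    K-off : ∀ {k} → k < 4 → off (K k) ⊆ E
    K-off k<4 {x , y} h = link (off-≢ h) (inj₂ (inj₂ (trans (fiber-∈ (off-∈ˡ h)) (sym (fiber-∈ (off-∈ʳ h))) ,
      subst (_< 4) (sym (fiber-∈ (off-∈ˡ h))) k<4)))

  -- The witness `b` is the number of vertices outside the dominating clique. The term `a * b`
  -- occurs once for each direction of the join.
  H-arcs : ∃ λ b → n ≡ a + b ×
    ## E ≡ arcs a + (a * b + (a * b + (arcs (suc p₂) + (arcs (suc p₃) + arcs (suc p₄)))))
  H-arcs = # O , trans (sym (#-full {n})) (trans (#-peel (λ _ → ∈-full)) (cong (_+ # O) (#-K 0<4))) ,
    trans (##-peel (K-off 0<4)) (cong₂ _+_ (off-size 0<4)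
    (trans (##-peel D⊆) (cong₂ _+_ D-size
    (trans (##-peel Dᵀ⊆) (cong₂ _+_ (trans (##-ᵀ D) D-size)
    (trans (##-peel λ {x} → L₁⊆ {x}) (cong₂ _+_ (off-size 1<4)
    (trans (##-peel λ {x} → L₂⊆ {x}) (cong₂ _+_ (off-size 2<4)
    (trans (##-peel λ {x} → L₃⊆ {x}) (trans (cong₂ _+_ (off-size 3<4) nothing-left) (+-identityʳ _))))))))))))
    where
    0<4 : 0 < 4
    0<4 = s≤s z≤n
    1<4 : 1 < 4
    1<4 = s≤s (s≤s z≤n)
    2<4 : 2 < 4
    2<4 = s≤s (s≤s (s≤s z≤n))
    3<4 : 3 < 4
    3<4 = s≤s (s≤s (s≤s (s≤s z≤n)))
    O : Subset (Fin n)
    O = full ∖ K 0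
    D : Subset (Fin n × Fin n)
    D = K 0 ⊗ O
    off-size : ∀ {k} → k < 4 → ## (off (K k)) ≡ arcs (size k)
    off-size {k} k<4 = trans (##-off-arcs (K k)) (cong arcs (#-K k<4))
    D-size : ## D ≡ a * # O
    D-size = trans (##-⊗ (K 0) O) (cong (_* # O) (#-K 0<4))
    D-≢ : ∀ {x y} → (x , y) ∈ D → x ≢ y
    D-≢ h refl = ∖-∉ (⊗-∈ʳ h) (⊗-∈ˡ h)
    D⊆ : D ⊆ E ∖ off (K 0)
    D⊆ {x , y} h = ∈-∖ (link (D-≢ h) (inj₁ (fiber-∈ (⊗-∈ˡ h)))) λ o → ∖-∉ (⊗-∈ʳ h) (off-∈ʳ o)
    Dᵀ⊆ : D ᵀ ⊆ E ∖ off (K 0) ∖ D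
    Dᵀ⊆ {x , y} h′ = ∈-∖ (∈-∖ (link (D-≢ h ∘ sym) (inj₂ (inj₁ (fiber-∈ (⊗-∈ˡ h))))) λ o → ∖-∉ (⊗-∈ʳ h) (off-∈ˡ o))
      λ d → ∖-∉ (⊗-∈ʳ h) (⊗-∈ˡ d)
      where h = ᵀ-∈ h′
    E₀ = E ∖ off (K 0) ∖ D ∖ D ᵀ
    inE₀ : ∀ {k} → suc k < 4 → off (K (suc k)) ⊆ E₀
    inE₀ k<4 {x , y} h = ∈-∖ (∈-∖ (∈-∖ (K-off k<4 h) λ o → 0≢1+n (K-unique (off-∈ˡ o) (off-∈ˡ h)))
      λ d → 0≢1+n (K-unique (⊗-∈ˡ d) (off-∈ˡ h))) λ d → 0≢1+n (K-unique (⊗-∈ˡ (ᵀ-∈ d)) (off-∈ʳ h))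
    apart : ∀ {k l x y} → k ≢ l → (x , y) ∈ off (K k) → (x , y) ∉ off (K l)
    apart k≢l h h′ = k≢l (K-unique (off-∈ˡ h) (off-∈ˡ h′))
    L₁⊆ : off (K 1) ⊆ E₀
    L₁⊆ = inE₀ 1<4
    L₂⊆ : off (K 2) ⊆ E₀ ∖ off (K 1)
    L₂⊆ h = ∈-∖ (inE₀ 2<4 h) (apart (λ ()) h)
    L₃⊆ : off (K 3) ⊆ E₀ ∖ off (K 1) ∖ off (K 2)
    L₃⊆ h = ∈-∖ (∈-∖ (inE₀ 3<4 h) (apart (λ ()) h)) (apart (λ ()) h)
    left : Subset (Fin n × Fin n)
    left = E₀ ∖ off (K 1) ∖ off (K 2) ∖ off (K 3)
    none : ∀ {x y} → (x , y) ∉ left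
    none {x} {y} h = go (κ x) (κ y) refl refl (linked e)
      where
      h₀ = ∖-∈ (∖-∈ (∖-∈ h))
      e = ∖-∈ (∖-∈ (∖-∈ h₀))
      x≢y : x ≢ y
      x≢y refl = arcsOf-irr (H n p₁ p₂ p₃ p₄) e
      both : ∀ {k} → κ x ≡ k → κ y ≡ k → (x , y) ∈ off (K k)
      both i j = ∈-off (∈-fiber i) (∈-fiber j) x≢y
      outer : ∀ {z k} → κ z ≡ suc k → z ∈ O
      outer i = ∈-∖ ∈-full λ z∈ → 0≢1+n (trans (sym (fiber-∈ z∈)) i)
      go : ∀ k l → κ x ≡ k → κ y ≡ l → Linked k l → ⊥
      go zero zero i j _ = ∖-∉ (∖-∈ (∖-∈ h₀)) (both i j)
      go zero (suc l) i j _ = ∖-∉ (∖-∈ h₀) (∈-⊗ (∈-fiber i) (outer j))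
      go (suc k) zero i j _ = ∖-∉ h₀ (∈-ᵀ (∈-⊗ (∈-fiber j) (outer i)))
      go 1 (suc l) i j (inj₂ (inj₂ (refl , _))) = ∖-∉ (∖-∈ (∖-∈ h)) (both i j)
      go 2 (suc l) i j (inj₂ (inj₂ (refl , _))) = ∖-∉ (∖-∈ h) (both i j)
      go 3 (suc l) i j (inj₂ (inj₂ (refl , _))) = ∖-∉ h (both i j)
      go (suc (suc (suc (suc k)))) (suc l) i j (inj₂ (inj₂ (_ , s≤s (s≤s (s≤s (s≤s ()))))))
    nothing-left : ## left ≡ 0
    nothing-left = n≤0⇒n≡0 (≤-trans (##-mono {R = ∅ ⊗ ∅} λ { {x , y} h → ⊥-elim (none h) })
      (≤-reflexive (trans (##-⊗ {n} {n} ∅ ∅) (cong (_* # {n} ∅) (#-∅ {n})))))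

  -- Saturation of H

  module _ (2≤p₁ : 2 ≤ p₁) (p₁≤p₂ : p₁ ≤ p₂) (p₂≤p₃ : p₂ + p₁ ≤ p₃) (p₃≤p₄ : p₃ + p₁ ≤ p₄) where

    private
      a+2 : a + 2 ≡ p₁
      a+2 = m∸n+n≡m 2≤p₁
      p₁≤p₃ : p₁ ≤ p₃
      p₁≤p₃ = ≤-trans (m≤n+m p₁ p₂) p₂≤p₃
      p₁≤p₄ : p₁ ≤ p₄
      p₁≤p₄ = ≤-trans (m≤n+m p₁ p₃) p₃≤p₄

    private
      -- Outside `K 0` adjacency means equal classes, so `x` fixes the class of every other vertex
      -- of the clique that is not in `K 0`.
      over-one : ∀ {S x y} → off S ⊆ E → x ∈ S ∖ K 0 → y ∈ S ∖ K 0 → x ≢ y →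
        ∃ λ k → k < 3 × (∀ {z} → z ∈ S → z ∈ K 0 ∪ K (suc k))
      over-one {S} {x} {y} cl x∈ y∈ x≢y = at (κ x) refl (linked (cl (∈-off (∖-∈ x∈) (∖-∈ y∈) x≢y)))
        where
        nonzero : ∀ {z} → z ∈ S ∖ K 0 → κ z ≢ 0
        nonzero z∈ e = ∖-∉ z∈ (∈-fiber e)
        at : ∀ k → κ x ≡ k → Linked (κ x) (κ y) → ∃ λ k → k < 3 × (∀ {z} → z ∈ S → z ∈ K 0 ∪ K (suc k))
        at _ e (inj₁ i) = ⊥-elim (nonzero x∈ i)
        at _ e (inj₂ (inj₁ i)) = ⊥-elim (nonzero y∈ i)
        at zero e (inj₂ (inj₂ _)) = ⊥-elim (nonzero x∈ e)
        at (suc k) e (inj₂ (inj₂ (_ , lt))) = k , s≤s⁻¹ (subst (_< 4) e lt) , cover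
          where
          cover : ∀ {z} → z ∈ S → z ∈ K 0 ∪ K (suc k)
          cover {z} z∈ with z ∈? K 0 | x ≟ z
          ... | yes z∈₀ | _ = ∈-∪ˡ z∈₀
          ... | no _ | yes refl = ∈-∪ʳ (∈-fiber e)
          ... | no z∉₀ | no x≢z with linked (cl (∈-off (∖-∈ x∈) z∈ x≢z))
          ...   | inj₁ i = ⊥-elim (nonzero x∈ i)
          ...   | inj₂ (inj₁ i) = ⊥-elim (z∉₀ (∈-fiber i))
          ...   | inj₂ (inj₂ (i , _)) = ∈-∪ʳ (∈-fiber (trans (sym i) e))

    locate : ∀ {S} → off S ⊆ E → p₁ ≤ # S → ∃ λ k → k < 3 × (∀ {z} → z ∈ S → z ∈ K 0 ∪ K (suc k))
    locate {S} cl p₁≤ = over-one cl (proj₂ first) (proj₁ (proj₂ second))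
        λ e → proj₂ (proj₂ second) (subst (_∈ ｛ proj₁ first ｝) e (∈-self _))
      where
      two : 2 ≤ # (S ∖ K 0)
      two = +-cancelˡ-≤ a 2 _ (≤-trans (≤-reflexive a+2) (≤-trans p₁≤ (≤-trans (≤-reflexive (#-split S (K 0)))
        (+-monoˡ-≤ _ (≤-trans (#-mono ∩-∈ʳ) (≤-reflexive (#-K (s≤s z≤n))))))))
      first : ∃ (_∈ S ∖ K 0)
      first = #-pick (S ∖ K 0) (≤-trans (s≤s z≤n) two)
      second : ∃ λ y → y ∈ S ∖ K 0 × y ∉ ｛ proj₁ first ｝
      second = #-pick-∖ ｛ proj₁ first ｝ (S ∖ K 0) (subst (_< # (S ∖ K 0)) (sym (#-｛｝ (proj₁ first))) two)

    -- By `locate`, each of the four cliques fits over one of three classes, and `K 0` with the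
    -- class of order pᵢ + 1 has room for p₁ + pᵢ - 1 vertices. A clique of order at least pᵢ + p₁
    -- is too large for this room (`apart`), and so are a clique of order pᵢ and another of order at
    -- least p₁ together (`tight`). Placing the cliques from the largest down therefore forces each
    -- into its own room, and none is left for the clique of order p₁.
    H-free : ¬ Contains (H n p₁ p₂ p₃ p₄) (F p₁ p₂ p₃ p₄)
    H-free c = place₄ (locate (clique P) (≤-trans p₁≤p₄ (≤-reflexive (sym (sizeP 3)))))
      where
      P = copy⇒packing p₁ p₂ p₃ p₄ {A = Adj (H n p₁ p₂ p₃ p₄)} c
      sizeP : ∀ k → # (part P k) ≡ orders p₁ p₂ p₃ p₄ k
      sizeP = copy⇒packing-size p₁ p₂ p₃ p₄ {A = Adj (H n p₁ p₂ p₃ p₄)} c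
      Over : ℕ → ℕ → Set
      Over k j = ∀ {z} → z ∈ part P k → z ∈ K 0 ∪ K (suc j)
      room : ∀ {j} → j < 3 → # (K 0 ∪ K (suc j)) ≤ a + size (suc j)
      room j<3 = ≤-trans (#-∪ ∪-∈) (≤-reflexive (cong₂ _+_ (#-K (s≤s z≤n)) (#-K (s≤s j<3))))
      alone : ∀ {k j} → j < 3 → Over k j → orders p₁ p₂ p₃ p₄ k ≤ a + size (suc j)
      alone {k} j<3 o = ≤-trans (≤-reflexive (sym (sizeP k))) (≤-trans (#-mono o) (room j<3))
      together : ∀ {k l j} → k ≢ l → j < 3 → Over k j → Over l j →
        orders p₁ p₂ p₃ p₄ k + orders p₁ p₂ p₃ p₄ l ≤ a + size (suc j)
      together {k} {l} k≢l j<3 o o′ = ≤-trans (≤-reflexive (cong₂ _+_ (sym (sizeP k)) (sym (sizeP l))))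
        (≤-trans (#-disjoint o o′ λ h h′ → k≢l (disjoint P h h′)) (room j<3))
      tight : ∀ {k j} → p₁ ≤ k → k + j ≤ a + suc j → ⊥
      tight {k} {j} p₁≤ h = <⇒≱ (≤-trans (≤-reflexive (trans (+-comm 2 a) a+2)) p₁≤)
        (+-cancelʳ-≤ j k (suc a) (≤-trans h (≤-reflexive (+-suc a j))))
      apart : ∀ {k l} → l + p₁ ≤ k → k ≤ a + suc l → ⊥
      apart {k} {l} l≤ h = <⇒≱ (≤-trans (≤-reflexive (identity a l)) (≤-trans (≤-reflexive (cong (l +_) a+2)) l≤)) h
        where
        identity : ∀ a l → suc (a + suc l) ≡ l + (a + 2)
        identity = solve-∀
      clash : ∀ {k l j} → k ≢ l → j < 3 → p₁ ≤ orders p₁ p₂ p₃ p₄ k → size (suc j) ≡ suc (orders p₁ p₂ p₃ p₄ l) →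
        Over k j → Over l j → ⊥
      clash k≢l j<3 p₁≤ e o o′ = tight p₁≤ (≤-trans (together k≢l j<3 o o′) (≤-reflexive (cong (a +_) e)))
      Place : ℕ → Set
      Place k = ∃ λ j → j < 3 × Over k j
      place₁ : Over 3 2 → Over 2 1 → Over 1 0 → Place 0 → ⊥
      place₁ o₄ o₃ o₂ (0 , j<3 , o) = clash {0} {1} (λ ()) j<3 ≤-refl refl o o₂
      place₁ o₄ o₃ o₂ (1 , j<3 , o) = clash {0} {2} (λ ()) j<3 ≤-refl refl o o₃
      place₁ o₄ o₃ o₂ (2 , j<3 , o) = clash {0} {3} (λ ()) j<3 ≤-refl refl o o₄
      place₁ _ _ _ (suc (suc (suc _)) , s≤s (s≤s (s≤s ())) , _)
      place₂ : Over 3 2 → Over 2 1 → Place 1 → ⊥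
      place₂ o₄ o₃ (0 , j<3 , o) = place₁ o₄ o₃ o (locate (clique P) (≤-reflexive (sym (sizeP 0))))
      place₂ o₄ o₃ (1 , j<3 , o) = clash {1} {2} (λ ()) j<3 p₁≤p₂ refl o o₃
      place₂ o₄ o₃ (2 , j<3 , o) = clash {1} {3} (λ ()) j<3 p₁≤p₂ refl o o₄
      place₂ _ _ (suc (suc (suc _)) , s≤s (s≤s (s≤s ())) , _)
      place₃ : Over 3 2 → Place 2 → ⊥
      place₃ o₄ (0 , j<3 , o) = apart p₂≤p₃ (alone {2} j<3 o)
      place₃ o₄ (1 , j<3 , o) = place₂ o₄ o (locate (clique P) (≤-trans p₁≤p₂ (≤-reflexive (sym (sizeP 1)))))
      place₃ o₄ (2 , j<3 , o) = clash {2} {3} (λ ()) j<3 p₁≤p₃ refl o o₄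
      place₃ _ (suc (suc (suc _)) , s≤s (s≤s (s≤s ())) , _)
      place₄ : Place 3 → ⊥
      place₄ (0 , j<3 , o) = apart (≤-trans (+-monoˡ-≤ p₁ (≤-trans (m≤m+n p₂ p₁) p₂≤p₃)) p₃≤p₄) (alone {3} j<3 o)
      place₄ (1 , j<3 , o) = apart p₃≤p₄ (alone {3} j<3 o)
      place₄ (2 , j<3 , o) = place₃ o (locate (clique P) (≤-trans p₁≤p₃ (≤-reflexive (sym (sizeP 2)))))
      place₄ (suc (suc (suc _)) , s≤s (s≤s (s≤s ())) , _)

    -- The new edge together with `K 0` is a clique of order p₁. The classes of order pᵢ + 1 can
    -- spare the endpoint they may lose.
    H-saturating : ∀ u v → u ≢ v → Adj (H n p₁ p₂ p₃ p₄) u v ≡ false →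
      ContainsAdj (addEdge (H n p₁ p₂ p₃ p₄) u v) (F p₁ p₂ p₃ p₄)
    H-saturating u v u≢v uv = packing⇒copy p₁ p₂ p₃ p₄ {A = addEdge (H n p₁ p₂ p₃ p₄) u v} P sizes
      where
      unlinked : ¬ Linked (κ u) (κ v)
      unlinked h with () ← trans (sym uv) (∈-elim (link u≢v h))
      V : ℕ → Subset (Fin n)
      V 0 = K 0 ∪ ｛ u ｝ ∪ ｛ v ｝
      V (suc k) with suc k <? 4
      ... | yes _ = K (suc k) ∖ ｛ u ｝ ∖ ｛ v ｝
      -- Class 4 is not a clique, so parts of index above 3 are empty; their prescribed order is 0.
      ... | no _ = ∅
      V-suc : ∀ {k x} → x ∈ V (suc k) → suc k < 4 × x ∈ K (suc k) ∖ ｛ u ｝ ∖ ｛ v ｝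
      V-suc {k} h with suc k <? 4
      ... | yes lt = lt , h
      ... | no _ = ⊥-elim (∉-∅ h)
      V-zero : ∀ {x} → x ∈ V 0 → κ x ≡ 0 ⊎ u ≡ x ⊎ v ≡ x
      V-zero h with ∪-∈ h
      ... | inj₂ e = inj₂ (inj₂ (∈-｛｝ e))
      ... | inj₁ h′ with ∪-∈ h′
      ...   | inj₁ e = inj₁ (fiber-∈ e)
      ...   | inj₂ e = inj₂ (inj₁ (∈-｛｝ e))
      old : ∀ {x y} → (x , y) ∈ E → (x , y) ∈ uncurry (addEdge (H n p₁ p₂ p₃ p₄) u v)
      old = addEdge-old (H n p₁ p₂ p₃ p₄) u v
      V-clique : ∀ {k} → off (V k) ⊆ uncurry (addEdge (H n p₁ p₂ p₃ p₄) u v)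
      V-clique {0} {x , y} h with V-zero (off-∈ˡ h) | V-zero (off-∈ʳ h)
      ... | inj₁ i | _ = old (link (off-≢ h) (inj₁ i))
      ... | inj₂ _ | inj₁ j = old (link (off-≢ h) (inj₂ (inj₁ j)))
      ... | inj₂ (inj₁ refl) | inj₂ (inj₁ refl) = ⊥-elim (off-≢ h refl)
      ... | inj₂ (inj₁ refl) | inj₂ (inj₂ refl) = addEdge-uv (H n p₁ p₂ p₃ p₄) u v
      ... | inj₂ (inj₂ refl) | inj₂ (inj₁ refl) = addEdge-vu (H n p₁ p₂ p₃ p₄) u v
      ... | inj₂ (inj₂ refl) | inj₂ (inj₂ refl) = ⊥-elim (off-≢ h refl)
      V-clique {suc k} {x , y} h with V-suc {k} (off-∈ˡ h) | V-suc {k} (off-∈ʳ h)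
      ... | lt , x∈ | _ , y∈ = old (K-off lt (∈-off (∖-∈ (∖-∈ x∈)) (∖-∈ (∖-∈ y∈)) (off-≢ h)))
      separate : ∀ {k x} → x ∈ V 0 → x ∈ V (suc k) → ⊥
      separate {k} h h′ with V-zero h | V-suc {k} h′
      ... | inj₁ i | _ , x∈ = 0≢1+n (trans (sym i) (fiber-∈ (∖-∈ (∖-∈ x∈))))
      ... | inj₂ (inj₁ refl) | _ , x∈ = ∖-∉ (∖-∈ x∈) (∈-self u)
      ... | inj₂ (inj₂ refl) | _ , x∈ = ∖-∉ x∈ (∈-self v)
      V-disjoint : ∀ {k l x} → x ∈ V k → x ∈ V l → k ≡ l
      V-disjoint {zero} {zero} _ _ = refl
      V-disjoint {zero} {suc l} h h′ = ⊥-elim (separate {l} h h′)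
      V-disjoint {suc k} {zero} h h′ = ⊥-elim (separate {k} h′ h)
      V-disjoint {suc k} {suc l} h h′ =
        K-unique (∖-∈ (∖-∈ (proj₂ (V-suc {k} h)))) (∖-∈ (∖-∈ (proj₂ (V-suc {l} h′))))
      P : Packing (uncurry (addEdge (H n p₁ p₂ p₃ p₄) u v))
      P = record { part = V ; clique = λ {k} → V-clique {k} ; disjoint = λ {k} {l} → V-disjoint {k} {l} }
      -- The endpoints of the new edge lie in different classes, so each class loses at most one vertex.
      loss : ∀ {k} → suc k < 4 → ∃ λ z → ∀ {x} → x ∈ K (suc k) → x ∈ K (suc k) ∖ ｛ u ｝ ∖ ｛ v ｝ ⊎ x ∈ ｛ z ｝
      loss {k} lt with u ∈? K (suc k)
      ... | yes u∈ = u , λ {x} x∈ → other {x} x∈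
        where
        other : ∀ {x} → x ∈ K (suc k) → x ∈ K (suc k) ∖ ｛ u ｝ ∖ ｛ v ｝ ⊎ x ∈ ｛ u ｝
        other {x} x∈ with x ∈? ｛ u ｝
        ... | yes e = inj₂ e
        ... | no ≢u = inj₁ (∈-∖ (∈-∖ x∈ ≢u) λ e → unlinked (inj₂ (inj₂ (trans (fiber-∈ u∈)
            (sym (fiber-∈ (subst (_∈ K (suc k)) (sym (∈-｛｝ e)) x∈))) , subst (_< 4) (sym (fiber-∈ u∈)) lt))))
      ... | no u∉ = v , λ {x} x∈ → other {x} x∈
        where
        other : ∀ {x} → x ∈ K (suc k) → x ∈ K (suc k) ∖ ｛ u ｝ ∖ ｛ v ｝ ⊎ x ∈ ｛ v ｝
        other {x} x∈ with x ∈? ｛ v ｝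
        ... | yes e = inj₂ e
        ... | no ≢v = inj₁ (∈-∖ (∈-∖ x∈ λ e → u∉ (subst (_∈ K (suc k)) (sym (∈-｛｝ e)) x∈)) ≢v)
      sizes′ : ∀ {k p} → suc k < 4 → size (suc k) ≡ suc p → p ≤ # (V (suc k))
      sizes′ {k} {p} lt e with suc k <? 4
      ... | no ¬lt = ⊥-elim (¬lt lt)
      ... | yes _ with z , cover ← loss {k} lt =
        +-cancelʳ-≤ 1 p _ (≤-trans (≤-reflexive (trans (+-comm p 1) (trans (sym e) (sym (#-K lt)))))
          (≤-trans (#-∪ cover) (≤-reflexive (cong (# (K (suc k) ∖ ｛ u ｝ ∖ ｛ v ｝) +_) (#-｛｝ z)))))
      sizes : ∀ k → orders p₁ p₂ p₃ p₄ k ≤ # (V k)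
      sizes 0 = ≤-trans (≤-reflexive (trans (sym a+2) (trans (+-comm a 2) (cong (2 +_) (sym (#-K (s≤s z≤n)))))))
        (#-insert₂ (∈-∪ˡ ∘ ∈-∪ˡ) (∈-∪ˡ (∈-∪ʳ (∈-self u))) (λ h → unlinked (inj₁ (fiber-∈ h)))
                   (∈-∪ʳ (∈-self v)) (λ h → unlinked (inj₂ (inj₁ (fiber-∈ h)))) u≢v)
      sizes 1 = sizes′ {0} (s≤s (s≤s z≤n)) refl
      sizes 2 = sizes′ {1} (s≤s (s≤s (s≤s z≤n))) refl
      sizes 3 = sizes′ {2} (s≤s (s≤s (s≤s (s≤s z≤n)))) refl
      sizes 4 = z≤n
      sizes (suc (suc (suc (suc (suc k))))) = z≤n

    H-saturated : Saturated (F p₁ p₂ p₃ p₄) (H n p₁ p₂ p₃ p₄)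
    H-saturated = H-free , H-saturating

-- Saturated graphs

minimum : (f : Fin (suc n) → ℕ) → ∃ λ x → ∀ y → f x ≤ f y
minimum {zero} f = zero , λ { zero → ≤-refl }
minimum {suc n} f with minimum (f ∘ suc)
... | x , least with f zero ≤? f (suc x)
...   | yes h = zero , λ { zero → ≤-refl ; (suc y) → ≤-trans h (least y) }
...   | no h = suc x , λ { zero → <⇒≤ (≰⇒> h) ; (suc y) → least y }

module _ {n p₁ p₂ p₃ p₄ : ℕ} {G : Graph n} (saturated : Saturated (F p₁ p₂ p₃ p₄) G)
         (4≤p₁ : 4 ≤ p₁) (p₁≤p₂ : p₁ ≤ p₂) (p₂≤p₃ : p₂ + p₁ ≤ p₃) (p₃≤p₄ : p₃ + p₁ ≤ p₄) where

  private
    a = p₁ ∸ 2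
    E = arcsOf G
    N = row E
    order = orders p₁ p₂ p₃ p₄
    a+2 : a + 2 ≡ p₁
    a+2 = m∸n+n≡m (≤-trans (s≤s (s≤s z≤n)) 4≤p₁)
    symm : Symm E
    symm = arcsOf-symm G
    irr : Irreflexive E
    irr = arcsOf-irr G
    p₁<p₃ : p₁ < p₃
    p₁<p₃ = ≤-trans (+-monoˡ-≤ p₁ (≤-trans (≤-trans (s≤s z≤n) 4≤p₁) p₁≤p₂)) p₂≤p₃
    p₁<p₄ : p₁ < p₄
    p₁<p₄ = ≤-trans p₁<p₃ (≤-trans (m≤m+n p₃ p₁) p₃≤p₄)

  record Joined (v w : Fin n) : Set where
    field
      packing : Packing (uncurry (addEdge G v w))
      sizes : ∀ k → # (part packing k) ≡ order k
      index : ℕ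
      v∈ : v ∈ part packing index
      w∈ : w ∈ part packing index
  open Joined

  opaque
    -- A copy created by the new edge must use it, since otherwise it would already be a copy in
    -- `G`. So some block of the copy contains both `v` and `w`.
    join : ∀ {v w} → v ≢ w → (v , w) ∉ E → Joined v w
    join {v} {w} v≢w vw with proj₂ saturated v w v≢w (∉⇒false vw)
    ... | c@(f , inj , adj) with any? (λ x → any? (λ y →
        (f x ≟ v) ×-dec ((f y ≟ w) ×-dec (ℕ._≟_ (block p₁ p₂ p₃ p₄ x) (block p₁ p₂ p₃ p₄ y)))))
    ...   | yes (x , y , refl , refl , e) = record
      { packing = copy⇒packing p₁ p₂ p₃ p₄ {A = addEdge G v w} c
      ; sizes = copy⇒packing-size p₁ p₂ p₃ p₄ {A = addEdge G v w} c
      ; index = block p₁ p₂ p₃ p₄ x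
      ; v∈ = ∈-image (∈-fiber refl)
      ; w∈ = ∈-image (∈-fiber (sym e))
      }
    ...   | no ¬p = ⊥-elim (proj₁ saturated (f , inj , λ x y h → unused x y h (addEdge-new G v w (adj x y h))))
      where
      unused : ∀ x y → Adj (F p₁ p₂ p₃ p₄) x y ≡ true →
        Adj G (f x) (f y) ≡ true ⊎ (f x ≡ v × f y ≡ w) ⊎ (f x ≡ w × f y ≡ v) → Adj G (f x) (f y) ≡ true
      unused x y h (inj₁ e) = e
      unused x y h (inj₂ (inj₁ (i , j))) = ⊥-elim (¬p (x , y , i , j , proj₂ (adj-F p₁ p₂ p₃ p₄ h)))
      unused x y h (inj₂ (inj₂ (i , j))) = ⊥-elim (¬p (y , x , j , i , sym (proj₂ (adj-F p₁ p₂ p₃ p₄ h))))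

  module _ {v w : Fin n} (v≢w : v ≢ w) (J : Joined v w) where

    private
      V = part (packing J)
      i = index J

      genuine : ∀ {k x y} → (x , y) ∈ off (V k) → ¬ (x ≡ v × y ≡ w) → ¬ (x ≡ w × y ≡ v) → (x , y) ∈ E
      genuine h ≢₁ ≢₂ with addEdge-new G v w (∈-elim (clique (packing J) h))
      ... | inj₁ e = ∈-intro e
      ... | inj₂ (inj₁ e) = ⊥-elim (≢₁ e)
      ... | inj₂ (inj₂ e) = ⊥-elim (≢₂ e)

    common : Subset (Fin n)
    common = V i ∖ ｛ v ｝ ∖ ｛ w ｝

    common-size : 2 + # common ≡ order i
    common-size = sym (trans (sym (sizes J i)) (trans (#-peel (inside (v∈ J))) (cong₂ _+_ (#-｛｝ v)
      (trans (#-peel (inside (∈-∖ (w∈ J) λ e → v≢w (∈-｛｝ e)))) (cong (_+ # common) (#-｛｝ w))))))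
      where
      inside : ∀ {x R} → x ∈ R → ｛ x ｝ ⊆ R
      inside {R = R} x∈ e = subst (_∈ R) (∈-｛｝ e) x∈

    private
      ≢v : ∀ {x} → x ∈ common → x ≢ v
      ≢v h refl = ∖-∉ (∖-∈ h) (∈-self v)
      ≢w : ∀ {x} → x ∈ common → x ≢ w
      ≢w h refl = ∖-∉ h (∈-self w)

    common⊆v : common ⊆ N v
    common⊆v h = ∈-row (genuine (∈-off (v∈ J) (∖-∈ (∖-∈ h)) (≢v h ∘ sym)) (≢w h ∘ proj₂) (≢v h ∘ proj₂))

    common⊆w : common ⊆ N w
    common⊆w h = ∈-row (genuine (∈-off (w∈ J) (∖-∈ (∖-∈ h)) (≢w h ∘ sym)) (≢w h ∘ proj₂) (≢v h ∘ proj₂))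

    common-clique : off common ⊆ E
    common-clique h = genuine (∈-off (∖-∈ (∖-∈ (off-∈ˡ h))) (∖-∈ (∖-∈ (off-∈ʳ h))) (off-≢ h))
      (≢v (off-∈ˡ h) ∘ proj₁) (≢w (off-∈ˡ h) ∘ proj₁)

    common-≥ : a ≤ # common
    common-≥ = +-cancelˡ-≤ 2 a _ (≤-trans (≤-reflexive (trans (+-comm 2 a) a+2)) (≤-trans (least i refl) (≤-reflexive (sym common-size))))
      where
      least : ∀ k → i ≡ k → p₁ ≤ order k
      least 0 _ = ≤-refl
      least 1 _ = p₁≤p₂
      least 2 _ = <⇒≤ p₁<p₃
      least 3 _ = <⇒≤ p₁<p₄
      -- Beyond index 3 the order is 0, yet the part contains the two vertices `v` and `w`.
      least 4 e with () ← trans common-size (cong order e)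
      least (suc (suc (suc (suc (suc k))))) e with () ← trans common-size (cong order e)

    module _ (tight : # (N v) ≤ a) where

      tight⊆ : N v ⊆ common
      tight⊆ = ⊆-≥⇒⊇ common⊆v (≤-trans tight common-≥)

      -- The part joining v and w is then v, w and all neighbours of v.
      remaining : Cliques (E ∩ (full ∖ N v ∖ ｛ v ｝) ⊗ (full ∖ N v ∖ ｛ v ｝)) p₂ p₃ p₄ w
      remaining = go i refl
        where
        W = full ∖ N v ∖ ｛ v ｝
        small : ∀ {k} → i ≡ k → order k ≤ p₁
        small refl = ≤-trans (≤-reflexive (sym common-size)) (≤-trans (s≤s (s≤s (≤-trans (#-mono common⊆v) tight)))
          (≤-reflexive (trans (+-comm 2 a) a+2)))
        v∉ : ∀ {l} → l ≢ i → v ∉ V l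
        v∉ l≢i h = l≢i (disjoint (packing J) h (v∈ J))
        w∉ : ∀ {l} → l ≢ i → w ∉ V l
        w∉ l≢i h = l≢i (disjoint (packing J) h (w∈ J))
        V⊆W : ∀ {l} → l ≢ i → V l ⊆ W
        V⊆W {l} l≢i h = ∈-∖ (∈-∖ ∈-full λ x∈ → l≢i (disjoint (packing J) h (∖-∈ (∖-∈ (tight⊆ x∈)))))
          λ e → v∉ l≢i (subst (_∈ V l) (sym (∈-｛｝ e)) h)
        V-clique : ∀ {l} → l ≢ i → off (V l) ⊆ E ∩ W ⊗ W
        V-clique {l} l≢i {x , y} h = ∈-∩ (genuine h (λ { (refl , _) → v∉ l≢i (off-∈ˡ h) }) (λ { (refl , _) → w∉ l≢i (off-∈ˡ h) }))
          (∈-⊗ (V⊆W l≢i (off-∈ˡ h)) (V⊆W l≢i (off-∈ʳ h)))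
        others : ∀ {k l m} → k ≢ i → l ≢ i → m ≢ i → k ≢ l → k ≢ m → l ≢ m →
          order k ≡ p₂ → order l ≡ p₃ → order m ≡ p₄ → Cliques (E ∩ W ⊗ W) p₂ p₃ p₄ w
        others {k} {l} {m} k≢i l≢i m≢i k≢l k≢m l≢m ek el em = record
          { P₁ = V k ; P₂ = V l ; P₃ = V m
          ; size₁ = trans (sizes J k) ek ; size₂ = trans (sizes J l) el ; size₃ = trans (sizes J m) em
          ; clique₁ = V-clique k≢i ; clique₂ = V-clique l≢i ; clique₃ = V-clique m≢i
          ; disjoint₁₂ = λ h h′ → k≢l (disjoint (packing J) h h′)
          ; disjoint₁₃ = λ h h′ → k≢m (disjoint (packing J) h h′)
          ; disjoint₂₃ = λ h h′ → l≢m (disjoint (packing J) h h′)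
          ; avoid₁ = w∉ k≢i ; avoid₂ = w∉ l≢i ; avoid₃ = w∉ m≢i
          }
        go : ∀ k → i ≡ k → Cliques (E ∩ W ⊗ W) p₂ p₃ p₄ w
        go 0 e = others {1} {2} {3} (λ j → 1+n≢0 (trans j e)) (λ j → 1+n≢0 (trans j e)) (λ j → 1+n≢0 (trans j e))
          (λ ()) (λ ()) (λ ()) refl refl refl
        -- The order of the joining part is at most p₁, so index 1 forces p₂ = p₁, and part 0 takes
        -- over the role of the clique of order p₂.
        go 1 e = others {0} {2} {3} (λ j → 0≢1+n (trans j e)) (λ j → 1+n≢0 (suc-injective (trans j e)))
          (λ j → 1+n≢0 (suc-injective (trans j e))) (λ ()) (λ ()) (λ ()) (≤-antisym p₁≤p₂ (small e)) refl refl
        go 2 e = ⊥-elim (<⇒≱ p₁<p₃ (small e))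
        go 3 e = ⊥-elim (<⇒≱ p₁<p₄ (small e))
        go 4 e with () ← trans common-size (cong order e)
        go (suc (suc (suc (suc (suc k))))) e with () ← trans common-size (cong order e)

  -- Counting arcs around a vertex and its nonneighbours

  module _ (v : Fin n) where

    private
      δ = # (N v)
      W = full ∖ N v ∖ ｛ v ｝

      W-≢ : ∀ {w} → w ∈ W → v ≢ w
      W-≢ h refl = ∖-∉ h (∈-self v)

      W-nonadjacent : ∀ {w} → w ∈ W → (v , w) ∉ E
      W-nonadjacent h e = ∖-∉ (∖-∈ h) (∈-row e)

      joined : ∀ {w} → w ∈ W → Joined v w
      joined h = join (W-≢ h) (W-nonadjacent h)

      v∉N : v ∉ N v
      v∉N h = irr (row-∈ h)

      W-size : n ≡ δ + (1 + # W)
      W-size = trans (sym (#-full {n})) (trans (#-peel {S = N v} (λ _ → ∈-full)) (cong (δ +_)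
        (trans (#-peel λ e → subst (_∈ full ∖ N v) (∈-｛｝ e) (∈-∖ ∈-full v∉N)) (cong (_+ # W) (#-｛｝ v)))))

    degree-≥ : ∃ (_∈ W) → a ≤ δ
    degree-≥ (w , h) = ≤-trans (common-≥ (W-≢ h) (joined h)) (#-mono (common⊆v (W-≢ h) (joined h)))

    -- Disjoint sets of arcs: from `v`, to `v`, inside `Q`, from `N v` into `W`, and out of `W`.
    -- Every vertex of `W` has at least `a` neighbours in `N v`, namely the common neighbours found
    -- by `join`.
    star-arcs : ∀ {x} {Q : Subset (Fin n)} → Q ⊆ N v → off Q ⊆ E → x ≤ ## (E ∩ W ⊗ full) →
      δ + (δ + (arcs (# Q) + (# W * a + x))) ≤ ## E
    star-arcs {Q = Q} Q⊆N cl rest =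
      ##-peel-≤ out⊆ out-size (##-peel-≤ in⊆ (≤-trans out-size (≤-reflexive (sym (##-ᵀ out))))
        (##-peel-≤ Q⊆ (≤-reflexive (sym (##-off-arcs Q)))
          (##-peel-≤ Y⊆ Y-size (≤-trans rest (##-mono Z⊆)))))
      where
      out : Subset (Fin n × Fin n)
      out = ｛ v ｝ ⊗ N v
      Y : Subset (Fin n × Fin n)
      Y = E ∩ W ⊗ N v
      out-size : δ ≤ ## out
      out-size = ≤-reflexive (sym (trans (##-⊗ ｛ v ｝ (N v)) (trans (cong (_* δ) (#-｛｝ v)) (+-identityʳ δ))))
      out⊆ : out ⊆ E
      out⊆ {x , y} h = subst (λ z → (z , y) ∈ E) (∈-｛｝ (⊗-∈ˡ h)) (row-∈ (⊗-∈ʳ h))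
      N∌ : ∀ {x} → x ∈ N v → x ∉ ｛ v ｝
      N∌ h e = v∉N (subst (_∈ N v) (sym (∈-｛｝ e)) h)
      W∌N : ∀ {x} → x ∈ W → x ∉ N v
      W∌N h = ∖-∉ (∖-∈ h)
      in⊆ : out ᵀ ⊆ E ∖ out
      in⊆ {x , y} h = ∈-∖ (symm (out⊆ (ᵀ-∈ h))) λ o → N∌ (⊗-∈ʳ (ᵀ-∈ h)) (⊗-∈ˡ o)
      Q⊆ : off Q ⊆ E ∖ out ∖ out ᵀ
      Q⊆ {x , y} h = ∈-∖ (∈-∖ (cl h) λ o → N∌ (Q⊆N (off-∈ˡ h)) (⊗-∈ˡ o)) λ o → N∌ (Q⊆N (off-∈ʳ h)) (⊗-∈ˡ (ᵀ-∈ o))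
      Y-size : # W * a ≤ ## (Y ᵀ)
      Y-size = ≤-trans (##-rows W Y λ {w} h → ≤-trans (common-≥ (W-≢ h) (joined h)) (#-mono λ {x} c →
          ∈-row (∈-∩ (row-∈ (common⊆w (W-≢ h) (joined h) c)) (∈-⊗ h (common⊆v (W-≢ h) (joined h) c)))))
        (≤-trans (##-mono ∩-∈ˡ) (≤-reflexive (sym (##-ᵀ Y))))
      Y⊆ : Y ᵀ ⊆ E ∖ out ∖ out ᵀ ∖ off Q
      Y⊆ {x , y} h′ = ∈-∖ (∈-∖ (∈-∖ (symm (∩-∈ˡ h)) λ o → N∌ (⊗-∈ʳ (∩-∈ʳ h)) (⊗-∈ˡ o))
          λ o → ∖-∉ (⊗-∈ˡ (∩-∈ʳ h)) (⊗-∈ˡ (ᵀ-∈ o))) λ o → W∌N (⊗-∈ˡ (∩-∈ʳ h)) (Q⊆N (off-∈ʳ o))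
        where h = ᵀ-∈ h′
      Z⊆ : E ∩ W ⊗ full ⊆ E ∖ out ∖ out ᵀ ∖ off Q ∖ Y ᵀ
      Z⊆ {x , y} h = ∈-∖ (∈-∖ (∈-∖ (∈-∖ (∩-∈ˡ h) λ o → ∖-∉ x∈ (⊗-∈ˡ o)) λ o → W∌N x∈ (⊗-∈ʳ (ᵀ-∈ o)))
          λ o → W∌N x∈ (Q⊆N (off-∈ˡ o))) λ o → W∌N x∈ (⊗-∈ʳ (∩-∈ʳ (ᵀ-∈ o)))
        where x∈ = ⊗-∈ˡ (∩-∈ʳ h)

    module _ {z b} (z≡ : z ≡ arcs (suc p₂) + arcs (suc p₃) + arcs (suc p₄)) (n≡ : n ≡ a + b) (large : 3 * a + z < n)
             (least : ∀ w → δ ≤ # (N w)) where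

      private
        bound = arcs a + (a * b + (a * b + z))

        rows-bound : ∀ {S : Subset (Fin n)} → # S * δ ≤ ## (E ∩ S ⊗ full)
        rows-bound {S} = ##-rows S E λ {w} _ → least w

        a≤z : a ≤ z
        a≤z = begin
          a             ≤⟨ m∸n≤m p₁ 2 ⟩
          p₁            ≤⟨ p₁≤p₂ ⟩
          p₂            ≤⟨ m≤m+n p₂ _ ⟩
          arcs (suc p₂) ≤⟨ m≤m+n (arcs (suc p₂)) _ ⟩
          arcs (suc p₂) + (arcs (suc p₃) + arcs (suc p₄)) ≡⟨ +-assoc (arcs (suc p₂)) _ _ ⟨
          arcs (suc p₂) + arcs (suc p₃) + arcs (suc p₄) ≡⟨ z≡ ⟨
          z             ∎
          where open ≤-Reasoning

        1≤a : 1 ≤ a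
        1≤a = ≤-trans (s≤s z≤n) (∸-monoˡ-≤ 2 4≤p₁)

      -- The degree sum is at least n(2a + 1) = 2an + n. Here n covers z, and 2an = 2a² + 2ab covers
      -- the rest.
      bound-high : 2 * a + 1 ≤ δ → bound ≤ ## E
      bound-high h = begin
        arcs a + (a * b + (a * b + z))           ≤⟨ +-mono-≤ arcs≤ (+-monoʳ-≤ (a * b) (+-monoʳ-≤ (a * b) z≤)) ⟩
        a * a + (a * b + (a * b + (a + b)))      ≤⟨ linear (a * a) ≤-refl (certificate a b) ⟩
        (a + b) * (2 * a + 1)                    ≡⟨ cong (_* (2 * a + 1)) n≡ ⟨
        n * (2 * a + 1)                          ≤⟨ *-monoʳ-≤ n h ⟩
        n * δ                                    ≡⟨ cong (_* δ) (#-full {n}) ⟨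
        # {n} full * δ                           ≤⟨ rows-bound ⟩
        ## (E ∩ full ⊗ full)                     ≤⟨ ##-mono ∩-∈ˡ ⟩
        ## E                                     ∎
        where
        open ≤-Reasoning
        arcs≤ : arcs a ≤ a * a
        arcs≤ = *-monoʳ-≤ a (m∸n≤m a 1)
        z≤ : z ≤ a + b
        z≤ = ≤-trans (m≤n+m z (3 * a)) (≤-trans (<⇒≤ large) (≤-reflexive n≡))
        certificate : ∀ a b → a * a + (a * b + (a * b + (a + b))) + 0 + a * a ≡ (a + b) * (2 * a + 1) + 0
        certificate = solve-∀

      private
        -- The lower bound a on the degree needs a nonneighbour of `v`; n > 3a + z leaves one as
        -- soon as δ ≤ 2a, which is why very large δ is split off in `bound-high`.
        vacant : δ ≤ 2 * a → ∃ (_∈ W)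
        vacant h = #-pick W (+-cancelˡ-≤ (1 + 2 * a) 1 (# W) (begin
          1 + 2 * a + 1         ≤⟨ +-monoʳ-≤ (1 + 2 * a) 1≤a ⟩
          1 + 2 * a + a         ≤⟨ m≤m+n _ z ⟩
          1 + 2 * a + a + z     ≡⟨ identity a z ⟩
          suc (3 * a + z)       ≤⟨ large ⟩
          n                     ≡⟨ W-size ⟩
          δ + (1 + # W)         ≤⟨ +-monoˡ-≤ (1 + # W) h ⟩
          2 * a + (1 + # W)     ≡⟨ +-suc (2 * a) (# W) ⟩
          1 + 2 * a + # W       ∎))
          where
          open ≤-Reasoning
          identity : ∀ a z → 1 + 2 * a + a + z ≡ suc (3 * a + z)
          identity = solve-∀

      -- The surplus 1 + j of δ over a is collected at every vertex of `W`. Of `N v` itself only the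
      -- clique of common neighbours with one vertex of `W` is counted.
      bound-middle : ∀ {w j} → w ∈ W → δ ≡ a + (1 + j) → j ≤ a → bound ≤ ## E
      bound-middle {j = j} w∈₀ δ≡ j≤a = begin
        arcs a + (a * b + (a * b + z))               ≡⟨ cong (λ b → arcs a + (a * b + (a * b + z))) b≡ ⟩
        arcs a + (a * (2 + j + μ) + (a * (2 + j + μ) + z))
          -- What is needed reduces to 2a(1 + j) + z ≤ (1 + j)(2 + μ). Scaling `gap` by 1 + j leaves
          -- j² - 1 ≤ jz, which follows from j ≤ a ≤ z.
          ≤⟨ linear 1 (+-mono-≤ (*-monoʳ-≤ (1 + j) gap) (*-monoʳ-≤ j (≤-trans j≤a a≤z))) (certificate (arcs a) a z j μ) ⟩
        d + (d + (arcs a + (μ * a + μ * d)))         ≡⟨ cong (λ d → d + (d + (arcs a + (μ * a + μ * d)))) δ≡ ⟨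
        δ + (δ + (arcs a + (μ * a + μ * δ)))         ≤⟨ +-monoʳ-≤ δ (+-monoʳ-≤ δ (+-monoˡ-≤ _ (arcs-mono (common-≥ w≢ J)))) ⟩
        δ + (δ + (arcs (# (common w≢ J)) + (μ * a + μ * δ))) ≤⟨ star-arcs (common⊆v w≢ J) (common-clique w≢ J) rows-bound ⟩
        ## E                                         ∎
        where
        open ≤-Reasoning
        μ = # W
        d = a + (1 + j)
        w≢ = W-≢ w∈₀
        J = joined w∈₀
        n≡′ : n ≡ a + (2 + j + μ)
        n≡′ = trans W-size (trans (cong (_+ (1 + μ)) δ≡) (identity a j μ))
          where
          identity : ∀ a j m → a + (1 + j) + (1 + m) ≡ a + (2 + j + m)
          identity = solve-∀
        b≡ : b ≡ 2 + j + μ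
        b≡ = +-cancelˡ-≡ a b _ (trans (sym n≡) n≡′)
        gap : 2 * a + z ≤ 1 + j + μ
        gap = +-cancelˡ-≤ (1 + a) _ _ (≤-trans (≤-reflexive (identity a z)) (≤-trans large (≤-reflexive (trans n≡′ (+-suc a (1 + j + μ))))))
          where
          identity : ∀ a z → 1 + a + (2 * a + z) ≡ suc (3 * a + z)
          identity = solve-∀
        certificate : ∀ x a z j m →
          x + (a * (2 + j + m) + (a * (2 + j + m) + z)) + ((1 + j) * (1 + j + m) + j * z) + 1
          ≡ a + (1 + j) + (a + (1 + j) + (x + (m * a + m * (a + (1 + j))))) + ((1 + j) * (2 * a + z) + j * j)
        certificate = solve-∀

      -- Now `N v` is contained in every joining part, so it is a clique completely joined to `W`,
      -- as the dominating clique of H is. Only the arcs inside `W` remain to be estimated, and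
      -- `cliques-bound₃` gives z of them.
      bound-low : ∀ {w} → w ∈ W → δ ≡ a → bound ≤ ## E
      bound-low w₀∈ δ≡ = begin
        arcs a + (a * b + (a * b + z))              ≡⟨ cong (λ b → arcs a + (a * b + (a * b + z))) b≡ ⟩
        arcs a + (a * (1 + μ) + (a * (1 + μ) + z))  ≡⟨ identity (arcs a) a μ z ⟩
        a + (a + (arcs a + (μ * a + (μ * a + z))))  ≡⟨ cong (λ d → d + (d + (arcs d + (μ * a + (μ * a + z))))) δ≡ ⟨
        δ + (δ + (arcs δ + (μ * a + (μ * a + z))))  ≤⟨ star-arcs (λ h → h) N-clique W-rows ⟩
        ## E                                        ∎
        where
        open ≤-Reasoning
        μ = # W
        tight : δ ≤ a
        tight = ≤-reflexive δ≡
        b≡ : b ≡ 1 + μ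
        b≡ = +-cancelˡ-≡ a b (1 + μ) (trans (sym n≡) (trans W-size (cong (_+ (1 + μ)) δ≡)))
        identity : ∀ x a m z → x + (a * (1 + m) + (a * (1 + m) + z)) ≡ a + (a + (x + (m * a + (m * a + z))))
        identity = solve-∀
        N-clique : off (N v) ⊆ E
        N-clique h = common-clique (W-≢ w₀∈) (joined w₀∈)
          (∈-off (tight⊆ (W-≢ w₀∈) (joined w₀∈) tight (off-∈ˡ h)) (tight⊆ (W-≢ w₀∈) (joined w₀∈) tight (off-∈ʳ h)) (off-≢ h))
        L : Subset (Fin n × Fin n)
        L = E ∩ W ⊗ W
        family : ∀ w → Cliques L p₂ p₃ p₄ w
        family w with w ∈? W
        ... | yes w∈ = remaining (W-≢ w∈) (joined w∈) tight
        -- The induction wants a family for every vertex. For one outside `W` any family will do,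
        -- because its cliques stay inside `W`.
        ... | no w∉ = record
          { P₁ = P₁ T₀ ; P₂ = P₂ T₀ ; P₃ = P₃ T₀
          ; size₁ = size₁ T₀ ; size₂ = size₂ T₀ ; size₃ = size₃ T₀
          ; clique₁ = clique₁ T₀ ; clique₂ = clique₂ T₀ ; clique₃ = clique₃ T₀
          ; disjoint₁₂ = disjoint₁₂ T₀ ; disjoint₁₃ = disjoint₁₃ T₀ ; disjoint₂₃ = disjoint₂₃ T₀
          ; avoid₁ = avoid (clique₁ T₀) (≤-trans 2≤p₂ (≤-reflexive (sym (size₁ T₀))))
          ; avoid₂ = avoid (clique₂ T₀) (≤-trans 2≤p₃ (≤-reflexive (sym (size₂ T₀))))
          ; avoid₃ = avoid (clique₃ T₀) (≤-trans 2≤p₄ (≤-reflexive (sym (size₃ T₀))))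
          }
          where
          T₀ = remaining (W-≢ w₀∈) (joined w₀∈) tight
          2≤p₂ : 2 ≤ p₂
          2≤p₂ = ≤-trans (≤-trans (s≤s (s≤s z≤n)) 4≤p₁) p₁≤p₂
          2≤p₃ : 2 ≤ p₃
          2≤p₃ = ≤-trans (≤-trans (s≤s (s≤s z≤n)) 4≤p₁) (<⇒≤ p₁<p₃)
          2≤p₄ : 2 ≤ p₄
          2≤p₄ = ≤-trans (≤-trans (s≤s (s≤s z≤n)) 4≤p₁) (<⇒≤ p₁<p₄)
          -- A vertex of a nontrivial clique of L is an endpoint of an arc of L, so it lies in W.
          avoid : ∀ {S} → off S ⊆ L → 2 ≤ # S → w ∉ S
          avoid {S} cl 2≤ w∈ with #-pick-∖ ｛ w ｝ S (subst (_< # S) (sym (#-｛｝ w)) 2≤)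
          ... | y , y∈ , y∉ = w∉ (⊗-∈ˡ (∩-∈ʳ (cl (∈-off w∈ y∈ λ e → y∉ (subst (_∈ ｛ w ｝) e (∈-self w))))))
        W-rows : μ * a + z ≤ ## (E ∩ W ⊗ full)
        W-rows = ##-peel-≤ {S = W ⊗ N v} (λ { {x , y} h → ∈-∩ (W-N h) (∈-⊗ (⊗-∈ˡ h) ∈-full) })
          (≤-reflexive (sym (trans (##-⊗ W (N v)) (cong (μ *_) δ≡))))
          (≤-trans (≤-reflexive z≡) (≤-trans
            (cliques-bound₃ v (≤-trans 4≤p₁ p₁≤p₂) (≤-trans (+-monoʳ-≤ p₂ 4≤p₁) p₂≤p₃) (≤-trans (+-monoʳ-≤ p₃ 4≤p₁) p₃≤p₄)
              L-symm (irr ∘ ∩-∈ˡ) family)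
            (##-mono L⊆)))
          where
          W-N : ∀ {x y} → (x , y) ∈ W ⊗ N v → (x , y) ∈ E
          W-N h = row-∈ (common⊆w (W-≢ (⊗-∈ˡ h)) (joined (⊗-∈ˡ h)) (tight⊆ (W-≢ (⊗-∈ˡ h)) (joined (⊗-∈ˡ h)) tight (⊗-∈ʳ h)))
          L-symm : Symm L
          L-symm h = ∈-∩ (symm (∩-∈ˡ h)) (∈-⊗ (⊗-∈ʳ (∩-∈ʳ h)) (⊗-∈ˡ (∩-∈ʳ h)))
          L⊆ : L ⊆ E ∩ W ⊗ full ∖ W ⊗ N v
          L⊆ {x , y} h = ∈-∖ (∈-∩ (∩-∈ˡ h) (∈-⊗ (⊗-∈ˡ (∩-∈ʳ h)) ∈-full)) λ o → ∖-∉ (∖-∈ (⊗-∈ʳ (∩-∈ʳ h))) (⊗-∈ʳ o)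

      arcs-bound : bound ≤ ## E
      arcs-bound with 2 * a + 1 ≤? δ
      ... | yes h = bound-high h
      ... | no h with s≤s⁻¹ (≤-trans (≰⇒> h) (≤-reflexive (+-comm (2 * a) 1)))
      ...   | δ≤ with vacant δ≤
      ...     | w , w∈ with m≤n⇒∃[o]m+o≡n (degree-≥ (w , w∈))
      ...       | zero , e = bound-low w∈ (trans (sym e) (+-identityʳ a))
      ...       | suc j , e = bound-middle w∈ (sym e) (≤-trans (n≤1+n j) (+-cancelˡ-≤ a (suc j) a
                    (≤-trans (≤-reflexive e) (≤-trans δ≤ (≤-reflexive (cong (a +_) (+-identityʳ a)))))))

-- The saturation number and the number of edges of H

theorem1p2 : (n p1 p2 p3 p4 : ℕ) →
    4 ≤ p1 → p1 ≤ p2 → p2 + p1 ≤ p3 → p3 + p1 ≤ p4 →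
    3 * (p1 ∸ 2) + (p2 * (p2 + 1) + p3 * (p3 + 1) + p4 * (p4 + 1)) < n →
    SatNumberIs n (K4union p1 p2 p3 p4) (edges (Hgraph n p1 p2 p3 p4))
    × edges (Hgraph n p1 p2 p3 p4)
        ≡ (p1 ∸ 2) * ((n ∸ p1) + 2) + ((p1 ∸ 2) C 2)
          + ((suc p2 C 2) + (suc p3 C 2) + (suc p4 C 2))
    × Saturated (K4union p1 p2 p3 p4) (Hgraph n p1 p2 p3 p4)
theorem1p2 zero p1 p2 p3 p4 4≤p1 p1≤p2 p2≤p3 p3≤p4 ()
theorem1p2 n@(suc _) p1 p2 p3 p4 4≤p1 p1≤p2 p2≤p3 p3≤p4 large =
  ((Hgraph n p1 p2 p3 p4 , H-sat , refl) , minimal) , size , H-sat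
  where
  a = p1 ∸ 2
  z = arcs (suc p2) + arcs (suc p3) + arcs (suc p4)
  large′ : 3 * a + z < n
  large′ = subst (λ z → 3 * a + z < n) (identity p2 p3 p4) large
    where
    identity : ∀ p q r → p * (p + 1) + q * (q + 1) + r * (r + 1) ≡ suc p * p + suc q * q + suc r * r
    identity = solve-∀
  ≤arcs : ∀ {p} → 4 ≤ p → suc p ≤ arcs (suc p)
  ≤arcs {p} 4≤p = ≤-trans (≤-reflexive (sym (*-identityʳ (suc p)))) (*-monoʳ-≤ (suc p) (≤-trans (s≤s z≤n) 4≤p))
  4≤p2 = ≤-trans 4≤p1 p1≤p2
  4≤p3 = ≤-trans 4≤p2 (≤-trans (m≤m+n p2 p1) p2≤p3)
  4≤p4 = ≤-trans 4≤p3 (≤-trans (m≤m+n p3 p1) p3≤p4)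
  big : total (a ∷ suc p2 ∷ suc p3 ∷ suc p4 ∷ []) ≤ n
  big = begin
    a + (suc p2 + (suc p3 + (suc p4 + 0))) ≡⟨ identity a (suc p2) (suc p3) (suc p4) ⟩
    a + (suc p2 + suc p3 + suc p4)         ≤⟨ +-mono-≤ (m≤m+n a _) (+-mono-≤ (+-mono-≤ (≤arcs 4≤p2) (≤arcs 4≤p3)) (≤arcs 4≤p4)) ⟩
    3 * a + z                              ≤⟨ <⇒≤ large′ ⟩
    n                                      ∎
    where
    open ≤-Reasoning
    identity : ∀ a p q r → a + (p + (q + (r + 0))) ≡ a + (p + q + r)
    identity = solve-∀
  H-sat : Saturated (K4union p1 p2 p3 p4) (Hgraph n p1 p2 p3 p4)
  H-sat = H-saturated n p1 p2 p3 p4 big (≤-trans (s≤s (s≤s z≤n)) 4≤p1) p1≤p2 p2≤p3 p3≤p4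
  counted = H-arcs n p1 p2 p3 p4 big
  b = proj₁ counted
  n≡ : n ≡ a + b
  n≡ = proj₁ (proj₂ counted)
  H-double : 2 * edges (Hgraph n p1 p2 p3 p4) ≡ arcs a + (a * b + (a * b + z))
  H-double = trans (sym (handshake (Hgraph n p1 p2 p3 p4))) (trans (proj₂ (proj₂ counted))
    (cong (λ z → arcs a + (a * b + (a * b + z))) (sym (+-assoc (arcs (suc p2)) _ _))))
  minimal : (G : Graph n) → Saturated (K4union p1 p2 p3 p4) G → edges (Hgraph n p1 p2 p3 p4) ≤ edges G
  minimal G sat = *-cancelˡ-≤ 2 (begin
    2 * edges (Hgraph n p1 p2 p3 p4) ≡⟨ H-double ⟩
    arcs a + (a * b + (a * b + z))   ≤⟨ arcs-bound {G = G} sat 4≤p1 p1≤p2 p2≤p3 p3≤p4 (proj₁ least) refl n≡ large′ (proj₂ least) ⟩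
    ## (arcsOf G)                    ≡⟨ handshake G ⟩
    2 * edges G                      ∎)
    where
    open ≤-Reasoning
    least = minimum (λ v → # (row (arcsOf G) v))
  b≡ : b ≡ (n ∸ p1) + 2
  b≡ = +-cancelˡ-≡ a b _ (trans (sym n≡) (sym (begin
    a + ((n ∸ p1) + 2)  ≡⟨ cong (a +_) (+-comm (n ∸ p1) 2) ⟩
    a + (2 + (n ∸ p1))  ≡⟨ +-assoc a 2 (n ∸ p1) ⟨
    a + 2 + (n ∸ p1)    ≡⟨ cong (_+ (n ∸ p1)) (m∸n+n≡m (≤-trans (s≤s (s≤s z≤n)) 4≤p1)) ⟩
    p1 + (n ∸ p1)       ≡⟨ m+[n∸m]≡n p1≤n ⟩
    n                   ∎)))
    where
    open ≡-Reasoning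
    p1≤n : p1 ≤ n
    p1≤n = ≤-trans p1≤p2 (≤-trans (n≤1+n p2) (≤-trans (m≤m+n (suc p2) _) (≤-trans (m≤n+m _ a) big)))
  -- `a * ((n ∸ p1) + 2)` counts the edges leaving the dominating clique, and `a C 2` those inside
  -- it.
  size : edges (Hgraph n p1 p2 p3 p4) ≡ a * ((n ∸ p1) + 2) + (a C 2) + ((suc p2 C 2) + (suc p3 C 2) + (suc p4 C 2))
  size = *-cancelˡ-≡ _ _ 2 (begin
    2 * edges (Hgraph n p1 p2 p3 p4) ≡⟨ H-double ⟩
    arcs a + (a * b + (a * b + z))   ≡⟨ cong₂ (λ x y → x + (a * b + (a * b + y))) (arcs-C a)
        (cong₂ _+_ (cong₂ _+_ (arcs-C (suc p2)) (arcs-C (suc p3))) (arcs-C (suc p4))) ⟨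
    2 * (a C 2) + (a * b + (a * b + (2 * (suc p2 C 2) + 2 * (suc p3 C 2) + 2 * (suc p4 C 2))))
      ≡⟨ regroup (a * b) (a C 2) (suc p2 C 2) (suc p3 C 2) (suc p4 C 2) ⟩
    2 * (a * b + (a C 2) + ((suc p2 C 2) + (suc p3 C 2) + (suc p4 C 2)))
      ≡⟨ cong (λ b → 2 * (a * b + (a C 2) + ((suc p2 C 2) + (suc p3 C 2) + (suc p4 C 2)))) b≡ ⟩
    2 * (a * ((n ∸ p1) + 2) + (a C 2) + ((suc p2 C 2) + (suc p3 C 2) + (suc p4 C 2))) ∎)
    where
    open ≡-Reasoning
    regroup : ∀ x y u v w → 2 * y + (x + (x + (2 * u + 2 * v + 2 * w))) ≡ 2 * (x + y + (u + v + w))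
    regroup = solve-∀
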